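{- There is $n_0$ such that for all $n\ge n_0$ there exists an integer $b$ with $200\, n\ln n \leq b \leq 201\, n\ln n$ such that in the strict $(1:b)$ Avoider-Enforcer game on $E(K_n)$ Avoider has a strategy ensuring that at the end of the game Avoider's graph is a forest.
   Context: Avoider-Enforcer games on $E(K_n)$: two players, Avoider (who moves first) and Enforcer, alternately claim previously unclaimed edges of the complete graph $K_n$ until all edges are claimed; Avoider's graph is the graph on $V(K_n)$ formed by the edges he claimed. In the strict $(1:b)$ game, in each turn Avoider claims exactly $1$ unclaimed edge and Enforcer claims exactly $b$ unclaimed edges; if fewer than $b$ unclaimed edges remain at Enforcer's turn, he claims all of them. $\ln$ denotes the natural logarithm. -}

module Defs where

open import Data.Nat using (ℕ; zero; suc; _+_; _*_; _^_; _≤_; _<ᵇ_; _!)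
open import Data.Fin using (Fin; toℕ)
open import Data.Bool using (if_then_else_)
open import Data.List using (List; []; _∷_; _++_; [_]; length; concatMap; allFin)
open import Data.List.Membership.Propositional using (_∈_)
open import Data.List.Relation.Unary.Linked using (Linked)
open import Data.List.Relation.Unary.Unique.Propositional using (Unique)
open import Data.List.Relation.Binary.Permutation.Propositional using (_↭_)
open import Data.Product using (_×_; _,_; ∃)
open import Data.Sum using (_⊎_)
open import Relation.Nullary using (¬_)
open import Relation.Binary.PropositionalEquality using (_≡_)

-- An edge {i,j} of K_n is stored as the ordered pair (i , j) with i < j.
Edge : ℕ → Set
Edge n = Fin n × Fin n

allEdges : (n : ℕ) → List (Edge n)
allEdges n = concatMap (λ i → concatMap (λ j →
  if toℕ i <ᵇ toℕ j then [ (i , j) ] else []) (allFin n)) (allFin n)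

Adj : {n : ℕ} → List (Edge n) → Fin n → Fin n → Set
Adj A u v = ((u , v) ∈ A) ⊎ ((v , u) ∈ A)

HasCycle : {n : ℕ} → List (Edge n) → Set
HasCycle {n} A = ∃ λ (v : Fin n) → ∃ λ (ws : List (Fin n)) → ∃ λ (w : Fin n) →
  (1 ≤ length ws) × Unique (v ∷ ws ++ [ w ]) ×
  Linked (Adj A) (v ∷ ws ++ [ w ]) × Adj A w v

Forest : {n : ℕ} → List (Edge n) → Set
Forest A = ¬ HasCycle A

-- The strict (1:b) Avoider–Enforcer game.
-- A position (at Avoider's turn) is (A , U): Avoider's edges A and the
-- list U of still unclaimed edges. AvoiderForest b A U means Avoider has
-- a strategy from this position guaranteeing that his final graph is a
-- forest.  Avoider picks e from U (U ↭ e ∷ U'); Enforcer then claims a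
-- set F of exactly min(b, |U'|) unclaimed edges (U' ↭ F ++ R).

min : ℕ → ℕ → ℕ
min zero _ = zero
min (suc a) zero = zero
min (suc a) (suc c) = suc (min a c)

data AvoiderForest {n : ℕ} (b : ℕ) : List (Edge n) → List (Edge n) → Set where
  end  : ∀ {A} → Forest A → AvoiderForest b A []
  move : ∀ {A U} (e : Edge n) (U' : List (Edge n)) → U ↭ e ∷ U' →
         (∀ (F R : List (Edge n)) → length F ≡ min b (length U') →
            U' ↭ F ++ R → AvoiderForest b (e ∷ A) R) →
         AvoiderForest b A U

AvoiderCanKeepForest : ℕ → ℕ → Set
AvoiderCanKeepForest n b = AvoiderForest {n} b [] (allEdges n)

-- Comparisons between e^b and natural numbers, without reals.
-- expNum b k = k! * Σ_{j=0}^{k} b^j / j!   (a natural number).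
expNum : ℕ → ℕ → ℕ
expNum b zero = 1
expNum b (suc k) = suc k * expNum b k + b ^ suc k

-- N ≤ e^b  (partial sums of the exponential series increase to e^b;
-- e^b is irrational for b ≥ 1, so N ≤ e^b iff some partial sum ≥ N).
ExpGe : ℕ → ℕ → Set
ExpGe b N = ∃ λ k → N * (k !) ≤ expNum b k

-- e^b ≤ M  iff every partial sum is ≤ M.
ExpLe : ℕ → ℕ → Set
ExpLe b M = ∀ k → expNum b k ≤ M * (k !)

-- c·n·ln n ≤ b   ⇔   n^(c·n) ≤ e^b   (n ≥ 1)
LowerNLogN : ℕ → ℕ → ℕ → Set
LowerNLogN c n b = ExpGe b (n ^ (c * n))

-- b ≤ c·n·ln n   ⇔   e^b ≤ n^(c·n)   (n ≥ 1)
UpperNLogN : ℕ → ℕ → ℕ → Set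
UpperNLogN c n b = ExpLe b (n ^ (c * n))

{-# OPTIONS --safe #-}

-- Avoider keeps the components of his forest tiny. With k rounds remaining, the number of
-- unclaimed edges is about k b, while the vertices in components of size at least i number
-- only O(n / (Q 2^i)), where 2^Q ≥ n. Splitting pairs by the two component sizes, at most
-- O(n² / (Q 2^q)) pairs have size sum at least q, and at most n Q pairs lie inside components.
-- As b ≥ 30 n Q, some unclaimed edge joins two components of total size below q whenever
-- 4 n < k q Q 2^q. Always playing such an edge for the least such q creates components of
-- size at least q in the last 4 n / (q Q 2^q) rounds only, which in turn maintains the bound
-- on the number of vertices in large components down to the last move, provided that the
-- last round is almost full. Choosing b + 1 as a quotient ⌈N / t⌉ of the number N of
-- edges ensures this.
module Submission where

open import Defs
open import Data.Bool using (true; false; if_then_else_)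
open import Data.Fin using (Fin; toℕ; _≟_)
import Data.Fin.Properties as Fin
open import Data.List using (List; []; _∷_; _++_; [_]; length; map; concatMap; allFin; filter; upTo; cartesianProduct)
open import Data.List.Properties using (length-++; length-map; length-tabulate; length-upTo)
open import Data.List.Membership.Propositional using (_∈_; _∉_; find; lose)
open import Data.List.Membership.Propositional.Properties
open import Data.List.Relation.Unary.Any using (here; there; any?)
open import Data.List.Relation.Unary.All as All using ([]; _∷_)
open import Data.List.Relation.Unary.AllPairs using ([]; _∷_)
open import Data.List.Relation.Unary.Linked using (Linked; [-]; _∷_)
open import Data.List.Relation.Unary.Unique.Propositional using (Unique)
open import Data.List.Relation.Unary.Unique.Propositional.Properties as Unique using (Unique[x∷xs]⇒x∉xs)
open import Data.List.Relation.Binary.Permutation.Propositional using (_↭_; ↭⇒↭ₛ)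
open import Data.List.Relation.Binary.Permutation.Propositional.Properties using (↭-length; shift)
import Data.List.Relation.Binary.Permutation.Setoid.Properties as PermutationSetoid
open import Data.Nat using (ℕ; zero; suc; _+_; _*_; _^_; _∸_; _/_; _%_; _!; _≤_; _<_; _≤?_; _<?_; _<ᵇ_; z≤n; s≤s; s≤s⁻¹; NonZero; >-nonZero; >-nonZero⁻¹)
open import Data.Nat.Properties hiding (_≟_)
open import Data.Nat.DivMod using (m≡m%n+[m/n]*n; m%n<n; m/n*n≤m; /-monoˡ-≤; m*n/n≡m)
open import Data.Nat.Tactic.RingSolver using (solve-∀)
open import Data.Product using (_×_; _,_; ∃; proj₁; proj₂; swap)
open import Data.Sum using (_⊎_; inj₁; inj₂)
open import Data.Unit using (tt)
open import Function using (_∘_; id)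
open import Relation.Binary.Definitions using (tri<; tri≈; tri>)
open import Relation.Binary.PropositionalEquality using (_≡_; _≢_; refl; sym; trans; cong; cong₂; subst; setoid)
open import Relation.Nullary using (¬_; Dec; yes; no; contradiction)
open import Relation.Nullary.Decidable using (¬?; _×-dec_)

-- Comparison of the exponential series with powers of 1 + 1/d

^-distribʳ-* : ∀ o m n → (m * n) ^ o ≡ m ^ o * n ^ o
^-distribʳ-* zero    m n = refl
^-distribʳ-* (suc o) m n = trans (cong (m * n *_) (^-distribʳ-* o m n)) ([m*n]*[o*p]≡[m*o]*[n*p] m n (m ^ o) (n ^ o))

-- k! D^k times the k-th partial sum of the exponential series at X / D.
scaledExp : ℕ → ℕ → ℕ → ℕ
scaledExp D X zero    = 1
scaledExp D X (suc k) = suc k * D * scaledExp D X k + X ^ suc k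

scaledExp-0 : ∀ D k → scaledExp D 0 k ≡ D ^ k * k !
scaledExp-0 D zero = refl
scaledExp-0 D (suc k) rewrite scaledExp-0 D k = regroup (suc k) D (D ^ k) (k !)
  where
  regroup : ∀ a d x f → a * d * (x * f) + 0 ≡ d * x * (a * f)
  regroup = solve-∀

scaledExp-* : ∀ D b k → scaledExp D (D * b) k ≡ D ^ k * expNum b k
scaledExp-* D b zero = refl
scaledExp-* D b (suc k) = trans
  (cong₂ _+_ (cong (suc k * D *_) (scaledExp-* D b k)) (^-distribʳ-* (suc k) D b))
  (regroup (suc k) D (D ^ k) (expNum b k) (b ^ suc k))
  where
  regroup : ∀ a d x e y → a * d * (x * e) + d * x * y ≡ d * x * (a * e + y)
  regroup = solve-∀

^-suc-upper : ∀ X j → suc X ^ suc j ≤ X ^ suc j + suc j * suc X ^ j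
^-suc-upper X zero = ≤-reflexive (base X)
  where
  base : ∀ X → suc X * 1 ≡ X * 1 + 1 * 1
  base = solve-∀
^-suc-upper X (suc j) = begin
  suc X ^ suc (suc j)                                  ≡⟨ split X (suc X ^ suc j) ⟩
  X * suc X ^ suc j + suc X ^ suc j                     ≤⟨ +-monoˡ-≤ (suc X ^ suc j) (*-monoʳ-≤ X (^-suc-upper X j)) ⟩
  X * (X ^ suc j + suc j * suc X ^ j) + suc X ^ suc j   ≤⟨ m≤m+n _ (suc j * suc X ^ j) ⟩
  X * (X ^ suc j + suc j * suc X ^ j) + suc X ^ suc j + suc j * suc X ^ j
    ≡⟨ regroup X (X ^ suc j) (suc j) (suc X ^ j) ⟩
  X ^ suc (suc j) + suc (suc j) * suc X ^ suc j         ∎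
  where
  open ≤-Reasoning
  split : ∀ X a → suc X * a ≡ X * a + a
  split = solve-∀
  regroup : ∀ X a j p → X * (a + j * p) + suc X * p + j * p ≡ X * a + suc j * (suc X * p)
  regroup = solve-∀

^-suc-lower : ∀ X j → X ^ suc j + suc j * X ^ j ≤ suc X ^ suc j
^-suc-lower X zero = ≤-reflexive (base X)
  where
  base : ∀ X → X * 1 + 1 * 1 ≡ suc X * 1
  base = solve-∀
^-suc-lower X (suc j) = begin
  X ^ suc (suc j) + suc (suc j) * X ^ suc j             ≤⟨ m≤m+n _ (suc j * X ^ j) ⟩
  X ^ suc (suc j) + suc (suc j) * X ^ suc j + suc j * X ^ j ≡⟨ regroup X (X ^ j) (suc j) ⟩
  suc X * (X ^ suc j + suc j * X ^ j)                   ≤⟨ *-monoʳ-≤ (suc X) (^-suc-lower X j) ⟩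
  suc X ^ suc (suc j)                                   ∎
  where
  open ≤-Reasoning
  regroup : ∀ X a j → X * (X * a) + suc j * (X * a) + j * a ≡ suc X * (X * a + j * a)
  regroup = solve-∀

-- The mean value bounds summed over the series: differentiating the partial sum of order `k + 1`
-- gives the one of order `k`, and the scaling turns this into the factor `suc k`.
scaledExp-suc-upper : ∀ D X k →
  scaledExp D (suc X) (suc k) ≤ scaledExp D X (suc k) + suc k * scaledExp D (suc X) k
scaledExp-suc-upper D X zero = ≤-reflexive (base D X)
  where
  base : ∀ D X → 1 * D * 1 + suc X * 1 ≡ 1 * D * 1 + X * 1 + 1 * 1
  base = solve-∀
scaledExp-suc-upper D X (suc k) = begin
  suc (suc k) * D * scaledExp D (suc X) (suc k) + suc X ^ suc (suc k)
    ≤⟨ +-mono-≤ (*-monoʳ-≤ (suc (suc k) * D) (scaledExp-suc-upper D X k)) (^-suc-upper X (suc k)) ⟩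
  suc (suc k) * D * (scaledExp D X (suc k) + suc k * scaledExp D (suc X) k)
    + (X ^ suc (suc k) + suc (suc k) * suc X ^ suc k)
    ≡⟨ regroup (suc (suc k)) D (scaledExp D X (suc k)) (suc k) (scaledExp D (suc X) k)
         (X ^ suc (suc k)) (suc X ^ suc k) ⟩
  scaledExp D X (suc (suc k)) + suc (suc k) * scaledExp D (suc X) (suc k) ∎
  where
  open ≤-Reasoning
  regroup : ∀ a D g c h p q →
    a * D * (g + c * h) + (p + a * q) ≡ a * D * g + p + a * (c * D * h + q)
  regroup = solve-∀

scaledExp-suc-lower : ∀ D X k →
  scaledExp D X (suc k) + suc k * scaledExp D X k ≤ scaledExp D (suc X) (suc k)
scaledExp-suc-lower D X zero = ≤-reflexive (base D X)
  where
  base : ∀ D X → 1 * D * 1 + X * 1 + 1 * 1 ≡ 1 * D * 1 + suc X * 1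
  base = solve-∀
scaledExp-suc-lower D X (suc k) = begin
  scaledExp D X (suc (suc k)) + suc (suc k) * scaledExp D X (suc k)
    ≡⟨ regroup (suc (suc k)) D (scaledExp D X (suc k)) (suc k) (scaledExp D X k)
         (X ^ suc (suc k)) (X ^ suc k) ⟩
  suc (suc k) * D * (scaledExp D X (suc k) + suc k * scaledExp D X k)
    + (X ^ suc (suc k) + suc (suc k) * X ^ suc k)
    ≤⟨ +-mono-≤ (*-monoʳ-≤ (suc (suc k) * D) (scaledExp-suc-lower D X k)) (^-suc-lower X (suc k)) ⟩
  scaledExp D (suc X) (suc (suc k)) ∎
  where
  open ≤-Reasoning
  regroup : ∀ a D g c h p q →
    a * D * g + p + a * (c * D * h + q) ≡ a * D * (g + c * h) + (p + a * q)
  regroup = solve-∀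

-- A finite form of 1 - 1/D ≤ e^(-1/D) with D = d + 1: D times the increment bound is part of the
-- sum `G′`, so one copy of `G′` absorbs it.
scaledExp-ratio-upper : ∀ d X k → d * scaledExp (suc d) (suc X) k ≤ suc d * scaledExp (suc d) X k
scaledExp-ratio-upper d X zero = *-monoˡ-≤ 1 (n≤1+n d)
scaledExp-ratio-upper d X (suc k) = +-cancelˡ-≤ G′ _ _ (begin
  suc d * G′                                ≤⟨ *-monoʳ-≤ (suc d) (scaledExp-suc-upper (suc d) X k) ⟩
  suc d * (G + suc k * scaledExp (suc d) (suc X) k)
    ≡⟨ regroup (suc d) G (suc k) (scaledExp (suc d) (suc X) k) ⟩
  suc k * suc d * scaledExp (suc d) (suc X) k + suc d * G
    ≤⟨ +-monoˡ-≤ (suc d * G) (m≤m+n (suc k * suc d * scaledExp (suc d) (suc X) k) _) ⟩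
  G′ + suc d * G                            ∎)
  where
  open ≤-Reasoning
  G′ = scaledExp (suc d) (suc X) (suc k)
  G  = scaledExp (suc d) X (suc k)
  regroup : ∀ D g a h → D * (g + a * h) ≡ a * D * h + D * g
  regroup = solve-∀

scaledExp-upper : ∀ d X k → d ^ X * scaledExp (suc d) X k ≤ suc d ^ X * (suc d ^ k * k !)
scaledExp-upper d zero k = *-monoʳ-≤ 1 (≤-reflexive (scaledExp-0 (suc d) k))
scaledExp-upper d (suc X) k = begin
  d * d ^ X * scaledExp (suc d) (suc X) k     ≡⟨ regroup d (d ^ X) _ ⟩
  d ^ X * (d * scaledExp (suc d) (suc X) k)   ≤⟨ *-monoʳ-≤ (d ^ X) (scaledExp-ratio-upper d X k) ⟩
  d ^ X * (suc d * scaledExp (suc d) X k)     ≡⟨ regroup′ (d ^ X) (suc d) _ ⟩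
  suc d * (d ^ X * scaledExp (suc d) X k)     ≤⟨ *-monoʳ-≤ (suc d) (scaledExp-upper d X k) ⟩
  suc d * (suc d ^ X * (suc d ^ k * k !))     ≡⟨ *-assoc (suc d) (suc d ^ X) _ ⟨
  suc d ^ suc X * (suc d ^ k * k !)           ∎
  where
  open ≤-Reasoning
  regroup : ∀ a b c → a * b * c ≡ b * (a * c)
  regroup = solve-∀
  regroup′ : ∀ a b c → a * (b * c) ≡ b * (a * c)
  regroup′ = solve-∀

-- e ≤ (1 + 1/d)^(d+1)
expNum-upper : ∀ d b k → expNum b k * d ^ (suc d * b) ≤ suc d ^ (suc d * b) * k !
expNum-upper d b k = *-cancelˡ-≤ (suc d ^ k) {{m^n≢0 (suc d) k}} (begin
  suc d ^ k * (expNum b k * d ^ (suc d * b))             ≡⟨ regroup (suc d ^ k) (expNum b k) _ ⟩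
  d ^ (suc d * b) * (suc d ^ k * expNum b k)             ≡⟨ cong (d ^ (suc d * b) *_) (scaledExp-* (suc d) b k) ⟨
  d ^ (suc d * b) * scaledExp (suc d) (suc d * b) k      ≤⟨ scaledExp-upper d (suc d * b) k ⟩
  suc d ^ (suc d * b) * (suc d ^ k * k !)                ≡⟨ regroup′ (suc d ^ (suc d * b)) (suc d ^ k) _ ⟩
  suc d ^ k * (suc d ^ (suc d * b) * k !)                ∎)
  where
  open ≤-Reasoning
  regroup : ∀ a b c → a * (b * c) ≡ c * (a * b)
  regroup = solve-∀
  regroup′ : ∀ a b c → a * (b * c) ≡ b * (a * c)
  regroup′ = solve-∀

-- Order and argument grow together, since the increment bound lowers the order by one. Each step
-- gains `suc K * D` from the scaling and `suc K` from the increment.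
scaledExp-lower : ∀ D K → K ! * suc D ^ K ≤ scaledExp D K K
scaledExp-lower D zero = ≤-refl
scaledExp-lower D (suc K) = begin
  suc K * K ! * (suc D * suc D ^ K)             ≡⟨ regroup (suc K) (K !) D (suc D ^ K) ⟩
  suc K * D * (K ! * suc D ^ K) + suc K * (K ! * suc D ^ K)
    ≤⟨ +-mono-≤ (*-monoʳ-≤ (suc K * D) (scaledExp-lower D K)) (*-monoʳ-≤ (suc K) (scaledExp-lower D K)) ⟩
  suc K * D * scaledExp D K K + suc K * scaledExp D K K
    ≤⟨ +-monoˡ-≤ _ (m≤m+n (suc K * D * scaledExp D K K) (K ^ suc K)) ⟩
  scaledExp D K (suc K) + suc K * scaledExp D K K ≤⟨ scaledExp-suc-lower D K K ⟩
  scaledExp D (suc K) (suc K)                   ∎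
  where
  open ≤-Reasoning
  regroup : ∀ a f D p → a * f * (suc D * p) ≡ a * D * (f * p) + a * (f * p)
  regroup = solve-∀

-- (1 + 1/d)^d ≤ e
expNum-lower : ∀ d b → (d * b) ! * suc d ^ (d * b) ≤ d ^ (d * b) * expNum b (d * b)
expNum-lower d b = ≤-trans (scaledExp-lower d (d * b)) (≤-reflexive (scaledExp-* d b (d * b)))

-- The condition on `p` says ln n ≤ p ln(1 + 1/d), which is at most p / d; hence c n ln n ≤ c n p /
-- d ≤ b. The partial sum of order `d * b` is already large enough.
LowerNLogN-intro : ∀ d .{{_ : NonZero d}} c n b p → n * d ^ p ≤ suc d ^ p →
  p * (c * n) ≤ d * b → LowerNLogN c n b
LowerNLogN-intro d c n b p n≤ pcn≤ = d * b , *-cancelˡ-≤ (d ^ (d * b)) {{m^n≢0 d (d * b)}} (begin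
  d ^ (d * b) * (n ^ (c * n) * (d * b) !)     ≡⟨ regroup (d ^ (d * b)) (n ^ (c * n)) _ ⟩
  (d * b) ! * (n ^ (c * n) * d ^ (d * b))     ≤⟨ *-monoʳ-≤ ((d * b) !) power ⟩
  (d * b) ! * suc d ^ (d * b)                 ≤⟨ expNum-lower d b ⟩
  d ^ (d * b) * expNum b (d * b)              ∎)
  where
  open ≤-Reasoning
  regroup : ∀ a b c → a * (b * c) ≡ c * (b * a)
  regroup = solve-∀
  regroup′ : ∀ a b c → a * (b * c) ≡ a * b * c
  regroup′ = solve-∀
  power : n ^ (c * n) * d ^ (d * b) ≤ suc d ^ (d * b)
  z = d * b ∸ p * (c * n)
  power = subst (λ e → n ^ (c * n) * d ^ e ≤ suc d ^ e) (m+[n∸m]≡n pcn≤) (begin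
    n ^ (c * n) * d ^ (p * (c * n) + z)             ≡⟨ cong (n ^ (c * n) *_) (^-distribˡ-+-* d (p * (c * n)) z) ⟩
    n ^ (c * n) * (d ^ (p * (c * n)) * d ^ z)       ≡⟨ cong (λ e → n ^ (c * n) * (e * d ^ z)) (^-*-assoc d p (c * n)) ⟨
    n ^ (c * n) * ((d ^ p) ^ (c * n) * d ^ z)       ≡⟨ regroup′ (n ^ (c * n)) _ _ ⟩
    n ^ (c * n) * (d ^ p) ^ (c * n) * d ^ z         ≡⟨ cong (_* d ^ z) (^-distribʳ-* (c * n) n (d ^ p)) ⟨
    (n * d ^ p) ^ (c * n) * d ^ z                   ≤⟨ *-mono-≤ (^-monoˡ-≤ (c * n) n≤) (^-monoˡ-≤ z (n≤1+n d)) ⟩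
    (suc d ^ p) ^ (c * n) * suc d ^ z               ≡⟨ cong (_* suc d ^ z) (^-*-assoc (suc d) p (c * n)) ⟩
    suc d ^ (p * (c * n)) * suc d ^ z               ≡⟨ ^-distribˡ-+-* (suc d) (p * (c * n)) z ⟨
    suc d ^ (p * (c * n) + z)                       ∎)

-- Here ln n ≥ p ln(1 + 1/d) ≥ p / (d + 1). The excess exponent `z` is padded to both sides and then
-- cancelled.
UpperNLogN-intro : ∀ d .{{_ : NonZero d}} c n b p → suc d ^ p ≤ n * d ^ p →
  suc d * b ≤ p * (c * n) → UpperNLogN c n b
UpperNLogN-intro d c n b p ≤n ≤pcn k = *-cancelʳ-≤ _ _ (d ^ (suc d * b)) {{m^n≢0 d (suc d * b)}} (begin
  expNum b k * d ^ (suc d * b)                ≤⟨ expNum-upper d b k ⟩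
  suc d ^ (suc d * b) * k !                   ≤⟨ *-monoˡ-≤ (k !) power ⟩
  n ^ (c * n) * d ^ (suc d * b) * k !         ≡⟨ regroup (n ^ (c * n)) _ _ ⟩
  n ^ (c * n) * k ! * d ^ (suc d * b)         ∎)
  where
  open ≤-Reasoning
  regroup : ∀ a b c → a * b * c ≡ a * c * b
  regroup = solve-∀
  regroup′ : ∀ a b c → a * (b * c) ≡ a * b * c
  regroup′ = solve-∀
  power : suc d ^ (suc d * b) ≤ n ^ (c * n) * d ^ (suc d * b)
  z  = p * (c * n) ∸ suc d * b
  eq = m+[n∸m]≡n ≤pcn
  power = *-cancelʳ-≤ _ _ (d ^ z) {{m^n≢0 d z}} (begin
    suc d ^ (suc d * b) * d ^ z                 ≤⟨ *-monoʳ-≤ (suc d ^ (suc d * b)) (^-monoˡ-≤ z (n≤1+n d)) ⟩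
    suc d ^ (suc d * b) * suc d ^ z             ≡⟨ ^-distribˡ-+-* (suc d) (suc d * b) z ⟨
    suc d ^ (suc d * b + z)                     ≡⟨ cong (suc d ^_) eq ⟩
    suc d ^ (p * (c * n))                       ≡⟨ ^-*-assoc (suc d) p (c * n) ⟨
    (suc d ^ p) ^ (c * n)                       ≤⟨ ^-monoˡ-≤ (c * n) ≤n ⟩
    (n * d ^ p) ^ (c * n)                       ≡⟨ ^-distribʳ-* (c * n) n (d ^ p) ⟩
    n ^ (c * n) * (d ^ p) ^ (c * n)             ≡⟨ cong (n ^ (c * n) *_) (^-*-assoc d p (c * n)) ⟩
    n ^ (c * n) * d ^ (p * (c * n))             ≡⟨ cong (λ e → n ^ (c * n) * d ^ e) eq ⟨
    n ^ (c * n) * d ^ (suc d * b + z)           ≡⟨ cong (n ^ (c * n) *_) (^-distribˡ-+-* d (suc d * b) z) ⟩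
    n ^ (c * n) * (d ^ (suc d * b) * d ^ z)     ≡⟨ regroup′ (n ^ (c * n)) _ _ ⟩
    n ^ (c * n) * d ^ (suc d * b) * d ^ z       ∎)

-- Choice of the bias

switch-point : {P : ℕ → Set} → (∀ m → Dec (P m)) → ¬ P 0 → ∀ m → P m →
  ∃ λ i → ¬ P i × P (suc i)
switch-point P? ¬P0 zero Pm = contradiction Pm ¬P0
switch-point P? ¬P0 (suc m) Psm with P? m
... | yes Pm = switch-point P? ¬P0 m Pm
... | no ¬Pm = m , ¬Pm , Psm

n≤2^n : ∀ n → n ≤ 2 ^ n
n≤2^n zero = z≤n
n≤2^n (suc n) = begin
  1 + n               ≤⟨ +-mono-≤ (m^n>0 2 n) (n≤2^n n) ⟩
  2 ^ n + 2 ^ n       ≡⟨ cong (2 ^ n +_) (+-identityʳ (2 ^ n)) ⟨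
  2 ^ suc n           ∎
  where open ≤-Reasoning

-- `a * d ^ u ≤ D ^ u` encodes a ≤ (D / d)^u without fractions, here and in the next lemmas.
^-ratio-lower : ∀ a d D u x → a * d ^ u ≤ D ^ u → a ^ x * d ^ (u * x) ≤ D ^ (u * x)
^-ratio-lower a d D u x a≤ = begin
  a ^ x * d ^ (u * x)     ≡⟨ cong (a ^ x *_) (^-*-assoc d u x) ⟨
  a ^ x * (d ^ u) ^ x     ≡⟨ ^-distribʳ-* x a (d ^ u) ⟨
  (a * d ^ u) ^ x         ≤⟨ ^-monoˡ-≤ x a≤ ⟩
  (D ^ u) ^ x             ≡⟨ ^-*-assoc D u x ⟩
  D ^ (u * x)             ∎
  where open ≤-Reasoning

^-ratio-upper : ∀ a d D u x → D ^ u ≤ a * d ^ u → D ^ (u * x) ≤ a ^ x * d ^ (u * x)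
^-ratio-upper a d D u x ≤a = begin
  D ^ (u * x)             ≡⟨ ^-*-assoc D u x ⟨
  (D ^ u) ^ x             ≤⟨ ^-monoˡ-≤ x ≤a ⟩
  (a * d ^ u) ^ x         ≡⟨ ^-distribʳ-* x a (d ^ u) ⟩
  a ^ x * (d ^ u) ^ x     ≡⟨ cong (a ^ x *_) (^-*-assoc d u x) ⟩
  a ^ x * d ^ (u * x)     ∎
  where open ≤-Reasoning

^-ratio-mono : ∀ a d D {u v} → d ≤ D → u ≤ v → a * d ^ u ≤ D ^ u → a * d ^ v ≤ D ^ v
^-ratio-mono a d D {u} {v} d≤D u≤v a≤ = subst (λ e → a * d ^ e ≤ D ^ e) (m+[n∸m]≡n u≤v) (begin
  a * d ^ (u + w)         ≡⟨ cong (a *_) (^-distribˡ-+-* d u w) ⟩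
  a * (d ^ u * d ^ w)     ≡⟨ *-assoc a (d ^ u) (d ^ w) ⟨
  a * d ^ u * d ^ w       ≤⟨ *-mono-≤ a≤ (^-monoˡ-≤ w d≤D) ⟩
  D ^ u * D ^ w           ≡⟨ ^-distribˡ-+-* D u w ⟨
  D ^ (u + w)             ∎)
  where
  open ≤-Reasoning
  w = v ∸ u

linear≤2^ : ∀ c k y → c * suc k ≤ 2 ^ k → c * suc (k + y) ≤ 2 ^ (k + y)
linear≤2^ c k zero base rewrite +-identityʳ k = base
linear≤2^ c k (suc y) base rewrite +-suc k y = begin
  c * suc (suc (k + y))       ≤⟨ *-monoʳ-≤ c (m≤m+n (suc (suc (k + y))) (k + y)) ⟩
  c * (suc (suc (k + y)) + (k + y)) ≡⟨ regroup c (k + y) ⟩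
  2 * (c * suc (k + y))       ≤⟨ *-monoʳ-≤ 2 (linear≤2^ c k y base) ⟩
  2 ^ suc (k + y)             ∎
  where
  open ≤-Reasoning
  regroup : ∀ c z → c * (suc (suc z) + z) ≡ 2 * (c * suc z)
  regroup = solve-∀

-- p = ⌈ln n / ln (1 + 1/d)⌉ - 1 approximates d ln n to within a factor 1 + O(1/d + 1/p).
log-index : ∀ d u n → 2 * d ^ u ≤ suc d ^ u → 2 ≤ n →
  ∃ λ p → suc d ^ p ≤ n * d ^ p × n * d ^ suc p ≤ suc d ^ suc p
log-index d u n doubling 2≤n with switch-point (λ p → n * d ^ p ≤? suc d ^ p) ¬P0 (u * n) large
  where
  ¬P0 : ¬ (n * 1 ≤ 1)
  ¬P0 le = <⇒≱ 2≤n (≤-trans (≤-reflexive (sym (*-identityʳ n))) le)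
  large : n * d ^ (u * n) ≤ suc d ^ (u * n)
  large = ≤-trans (*-monoˡ-≤ (d ^ (u * n)) (n≤2^n n)) (^-ratio-lower 2 d (suc d) u n doubling)
... | p , ¬Pp , Psp = p , <⇒≤ (≰⇒> ¬Pp) , Psp

log-index-upper : ∀ d .{{_ : NonZero d}} v n p Q → suc d ^ v ≤ 2 * d ^ v →
  p ≤ v * Q → n * d ^ p ≤ suc d ^ p → n ≤ 2 ^ Q
log-index-upper d v n p Q doubling p≤ n≤ =
  *-cancelʳ-≤ n (2 ^ Q) (d ^ (v * Q)) {{m^n≢0 d (v * Q)}}
    (≤-trans (^-ratio-mono n d (suc d) (n≤1+n d) p≤ n≤)
             (^-ratio-upper 2 d (suc d) v Q doubling))

log-index-lower : ∀ d .{{_ : NonZero d}} u n p x → 2 * d ^ u ≤ suc d ^ u →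
  u * x ≤ p → suc d ^ p ≤ n * d ^ p → 2 ^ x ≤ n
log-index-lower d u n p x doubling ≤p ≤n =
  *-cancelʳ-≤ (2 ^ x) n (d ^ p) {{m^n≢0 d p}}
    (≤-trans (^-ratio-mono (2 ^ x) d (suc d) (n≤1+n d) ≤p
               (^-ratio-lower 2 d (suc d) u x doubling)) ≤n)

-- About 693 factors 1 + 1/1000 make 2; the crude bracket 500 to 1000 suffices to compare p with
-- log_2 n.
doubling-lower : 2 * 1000 ^ 1000 ≤ 1001 ^ 1000
doubling-lower = ≤ᵇ⇒≤ (2 * 1000 ^ 1000) (1001 ^ 1000) tt

doubling-upper : 1001 ^ 500 ≤ 2 * 1000 ^ 500
doubling-upper = ≤ᵇ⇒≤ (1001 ^ 500) (2 * 1000 ^ 500) tt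

-- b + 1 is chosen as ⌈N / t⌉, so that the last of the t rounds falls short of
-- b + 1 edges by r < t only.
round-lengths : ∀ N c κ → 1 ≤ κ → κ * suc c ≤ N → ∃ λ t → ∃ λ b → ∃ λ r →
  N + r ≡ t * suc b × r ≤ t × b * t ≤ N × c ≤ b × κ * b ≤ suc κ * suc c
round-lengths zero c (suc κ) _ ()
round-lengths N@(suc N′) c κ 1≤κ κc≤N =
  t , b , r , total , m∸n≤m t (suc ρ) , bt≤N , c≤b , upper
  where
  open ≤-Reasoning
  t : ℕ
  t = N / suc c
  κ≤t : κ ≤ t
  κ≤t = ≤-trans (≤-reflexive (sym (m*n/n≡m κ (suc c)))) (/-monoˡ-≤ (suc c) κc≤N)
  instance
    t≢0 : NonZero t
    t≢0 = >-nonZero (≤-trans 1≤κ κ≤t)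
  b ρ r : ℕ
  -- Dividing N - 1 instead of N makes `suc b` the ceiling of N / t; the remainder ρ < t leaves the
  -- shortfall t - 1 - ρ.
  b = N′ / t
  ρ = N′ % t
  r = t ∸ suc ρ
  N′≡ : N′ ≡ ρ + b * t
  N′≡ = m≡m%n+[m/n]*n N′ t
  ρ<t : suc ρ ≤ t
  ρ<t = m%n<n N′ t
  total : N + r ≡ t * suc b
  total = begin-equality
    suc N′ + r                ≡⟨ cong (λ z → suc z + r) N′≡ ⟩
    suc (ρ + b * t) + r       ≡⟨ regroup ρ (b * t) r ⟩
    (suc ρ + r) + b * t       ≡⟨ cong₂ _+_ (m+[n∸m]≡n ρ<t) (*-comm b t) ⟩
    t + t * b                 ≡⟨ *-suc t b ⟨
    t * suc b                 ∎
    where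
    regroup : ∀ x y z → suc (x + y) + z ≡ (suc x + z) + y
    regroup = solve-∀
  bt≤N : b * t ≤ N
  bt≤N = ≤-trans (m/n*n≤m N′ t) (n≤1+n N′)
  c≤b : c ≤ b
  c≤b = *-cancelʳ-≤ c b t (+-cancelʳ-≤ t _ _ (begin
    c * t + t                 ≡⟨ regroup c t ⟩
    t * suc c                 ≤⟨ m/n*n≤m N (suc c) ⟩
    suc N′                    ≡⟨ cong suc N′≡ ⟩
    suc ρ + b * t             ≤⟨ +-monoˡ-≤ (b * t) ρ<t ⟩
    t + b * t                 ≡⟨ +-comm t (b * t) ⟩
    b * t + t                 ∎))
    where
    regroup : ∀ c t → c * t + t ≡ t * suc c
    regroup = solve-∀
  N≤ : N ≤ suc c + t * suc c
  N≤ = begin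
    N                           ≡⟨ m≡m%n+[m/n]*n N (suc c) ⟩
    N % suc c + t * suc c       ≤⟨ +-monoˡ-≤ (t * suc c) (<⇒≤ (m%n<n N (suc c))) ⟩
    suc c + t * suc c           ∎
  -- Rounding the number of rounds down costs a factor (t + 1) / t, at most (κ + 1) / κ because κ ≤
  -- t.
  upper : κ * b ≤ suc κ * suc c
  upper = *-cancelʳ-≤ (κ * b) (suc κ * suc c) t (begin
    κ * b * t                   ≡⟨ *-assoc κ b t ⟩
    κ * (b * t)                 ≤⟨ *-monoʳ-≤ κ (≤-trans bt≤N N≤) ⟩
    κ * (suc c + t * suc c)     ≡⟨ *-distribˡ-+ κ (suc c) (t * suc c) ⟩
    κ * suc c + κ * (t * suc c) ≤⟨ +-monoˡ-≤ _ (*-monoˡ-≤ (suc c) κ≤t) ⟩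
    t * suc c + κ * (t * suc c) ≡⟨ regroup t κ (suc c) ⟩
    suc κ * suc c * t           ∎)
    where
    regroup : ∀ t k c → t * c + k * (t * c) ≡ suc k * c * t
    regroup = solve-∀

-- As 5 c is close to n p, b is near n p / 5. Two factors 1 + 1/α are lost, one by rounding the
-- number of rounds and one by the `suc α` of the exponential bound; p + 2 in place of p covers the
-- additive terms.
upper-condition : ∀ α .{{_ : NonZero α}} σ n p c b → 5 * c ≤ n * suc p + 5 → 10 ≤ n →
  α * b ≤ suc α * suc c → suc α * suc α * (p + 2) ≤ 5 * α * (σ * p) →
  suc α * b ≤ p * (σ * n)
upper-condition α σ n p c b c≤ 10≤n b≤ num =
  *-cancelˡ-≤ (5 * α) {{m*n≢0 5 α}} (begin
    5 * α * (suc α * b)                   ≡⟨ regroup₁ α b ⟩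
    5 * suc α * (α * b)                   ≤⟨ *-monoʳ-≤ (5 * suc α) b≤ ⟩
    5 * suc α * (suc α * suc c)           ≡⟨ regroup₂ (suc α) c ⟩
    suc α * suc α * (5 * c + 5)           ≤⟨ *-monoʳ-≤ (suc α * suc α) inner ⟩
    suc α * suc α * (n * (p + 2))         ≡⟨ regroup₃ (suc α * suc α) n (p + 2) ⟩
    suc α * suc α * (p + 2) * n           ≤⟨ *-monoˡ-≤ n num ⟩
    5 * α * (σ * p) * n                   ≡⟨ regroup₄ (5 * α) σ p n ⟩
    5 * α * (p * (σ * n))                 ∎)
  where
  open ≤-Reasoning
  regroup₁ : ∀ a b → 5 * a * (suc a * b) ≡ 5 * suc a * (a * b)
  regroup₁ = solve-∀
  regroup₂ : ∀ a c → 5 * a * (a * suc c) ≡ a * a * (5 * c + 5)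
  regroup₂ = solve-∀
  regroup₃ : ∀ a n q → a * (n * q) ≡ a * q * n
  regroup₃ = solve-∀
  regroup₄ : ∀ a s p n → a * (s * p) * n ≡ a * (p * (s * n))
  regroup₄ = solve-∀
  regroup₅ : ∀ n p → n * suc p + n ≡ n * (p + 2)
  regroup₅ = solve-∀
  inner : 5 * c + 5 ≤ n * (p + 2)
  inner = begin
    5 * c + 5                 ≤⟨ +-monoˡ-≤ 5 c≤ ⟩
    n * suc p + 5 + 5         ≡⟨ +-assoc (n * suc p) 5 5 ⟩
    n * suc p + 10            ≤⟨ +-monoʳ-≤ (n * suc p) 10≤n ⟩
    n * suc p + n             ≡⟨ regroup₅ n p ⟩
    n * (p + 2)               ∎

-- N is at least (n^2 - n) / 2 and κ (c + 1) is about κ n p / 5, so p up to about 5 n / (2 κ) is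
-- harmless; the extra 6 pays for lower-order terms.
enough-edges : ∀ κ n p c N → n * n ≤ N + N + n → 5 * c ≤ n * p + 5 → 20 * κ ≤ n → 1 ≤ p →
  (2 * κ + 6) * p ≤ 5 * n → κ * suc c ≤ N
enough-edges κ n p c N n²≤ c≤ κ≤n 1≤p num = *-cancelˡ-≤ 10 (+-cancelʳ-≤ (5 * n) _ _ (begin
  10 * (κ * suc c) + 5 * n            ≡⟨ regroup₁ κ c n ⟩
  2 * κ * (5 * c + 5) + 5 * n         ≤⟨ +-monoˡ-≤ (5 * n) (*-monoʳ-≤ (2 * κ) (+-monoˡ-≤ 5 c≤)) ⟩
  2 * κ * (n * p + 5 + 5) + 5 * n     ≡⟨ regroup₂ κ (n * p) n ⟩
  2 * κ * (n * p) + (20 * κ + 5 * n)  ≤⟨ +-monoʳ-≤ (2 * κ * (n * p)) small ⟩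
  2 * κ * (n * p) + 6 * (n * p)       ≡⟨ regroup₃ (2 * κ) n p ⟩
  n * ((2 * κ + 6) * p)               ≤⟨ *-monoʳ-≤ n num ⟩
  n * (5 * n)                         ≡⟨ regroup₄ n ⟩
  5 * (n * n)                         ≤⟨ *-monoʳ-≤ 5 n²≤ ⟩
  5 * (N + N + n)                     ≡⟨ regroup₅ N n ⟩
  10 * N + 5 * n                      ∎))
  where
  open ≤-Reasoning
  regroup₁ : ∀ k c n → 10 * (k * suc c) + 5 * n ≡ 2 * k * (5 * c + 5) + 5 * n
  regroup₁ = solve-∀
  regroup₂ : ∀ k x n → 2 * k * (x + 5 + 5) + 5 * n ≡ 2 * k * x + (20 * k + 5 * n)
  regroup₂ = solve-∀
  regroup₃ : ∀ k n p → k * (n * p) + 6 * (n * p) ≡ n * ((k + 6) * p)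
  regroup₃ = solve-∀
  regroup₄ : ∀ n → n * (5 * n) ≡ 5 * (n * n)
  regroup₄ = solve-∀
  regroup₅ : ∀ N n → 5 * (N + N + n) ≡ 10 * N + 5 * n
  regroup₅ = solve-∀
  small : 20 * κ + 5 * n ≤ 6 * (n * p)
  small = begin
    20 * κ + 5 * n    ≤⟨ +-monoˡ-≤ (5 * n) κ≤n ⟩
    n + 5 * n         ≡⟨⟩
    6 * n             ≤⟨ *-monoʳ-≤ 6 (m≤m*n n p {{>-nonZero 1≤p}}) ⟩
    6 * (n * p)       ∎

bias-large : ∀ v n p c b Q → n * p ≤ 5 * c → c ≤ b → v * Q ≤ p → 150 * suc Q ≤ v * Q →
  30 * (n * suc Q) ≤ b
bias-large v n p c b Q ≤c c≤b ≤p num = *-cancelˡ-≤ 5 (begin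
  5 * (30 * (n * suc Q))    ≡⟨ regroup n Q ⟩
  n * (150 * suc Q)         ≤⟨ *-monoʳ-≤ n (≤-trans num ≤p) ⟩
  n * p                     ≤⟨ ≤c ⟩
  5 * c                     ≤⟨ *-monoʳ-≤ 5 c≤b ⟩
  5 * b                     ∎)
  where
  open ≤-Reasoning
  regroup : ∀ n Q → 5 * (30 * (n * suc Q)) ≡ n * (150 * suc Q)
  regroup = solve-∀

few-rounds : ∀ n b t Q N → 1 ≤ n → N ≤ n * n → b * t ≤ N → 30 * (n * Q) ≤ b → 30 * (t * Q) ≤ n
few-rounds n b t Q N 1≤n N≤ bt≤N ≤b = *-cancelˡ-≤ n {{>-nonZero 1≤n}} (begin
  n * (30 * (t * Q))        ≡⟨ regroup n t Q ⟩
  30 * (n * Q) * t          ≤⟨ *-monoˡ-≤ t ≤b ⟩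
  b * t                     ≤⟨ ≤-trans bt≤N N≤ ⟩
  n * n                     ∎)
  where
  open ≤-Reasoning
  regroup : ∀ n t Q → n * (30 * (t * Q)) ≡ 30 * (n * Q) * t
  regroup = solve-∀

-- Reduces a condition on all large p to a comparison of slopes and one evaluation at `k`.
affine-≤ : ∀ a b s {k p} → a ≤ b → a * (k + s) ≤ b * k → k ≤ p → a * (p + s) ≤ b * p
affine-≤ a b s {k} {p} a≤b base k≤p = subst (λ q → a * (q + s) ≤ b * q) (m+[n∸m]≡n k≤p) (begin
  a * (k + y + s)       ≡⟨ regroup a k y s ⟩
  a * (k + s) + a * y   ≤⟨ +-mono-≤ base (*-monoˡ-≤ y a≤b) ⟩
  b * k + b * y         ≡⟨ *-distribˡ-+ b k y ⟨
  b * (k + y)           ∎)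
  where
  open ≤-Reasoning
  y = p ∸ k
  regroup : ∀ a k y s → a * (k + y + s) ≡ a * (k + s) + a * y
  regroup = solve-∀

m<[1+m/n]*n : ∀ m n .{{_ : NonZero n}} → suc m ≤ n * suc (m / n)
m<[1+m/n]*n m n = begin
  suc m                         ≡⟨ cong suc (m≡m%n+[m/n]*n m n) ⟩
  suc (m % n) + m / n * n       ≤⟨ +-monoˡ-≤ (m / n * n) (m%n<n m n) ⟩
  n + m / n * n                 ≡⟨ *-comm (suc (m / n)) n ⟩
  n * suc (m / n)               ∎
  where open ≤-Reasoning

n*[m/n]≤m : ∀ m n .{{_ : NonZero n}} → n * (m / n) ≤ m
n*[m/n]≤m m n = ≤-trans (≤-reflexive (*-comm n (m / n))) (m/n*n≤m m n)

≤-/ : ∀ k m n .{{_ : NonZero n}} → n * k ≤ m → k ≤ m / n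
≤-/ k m n nk≤m = begin
  k           ≡⟨ m*n/n≡m k n ⟨
  k * n / n   ≡⟨ cong (_/ n) (*-comm k n) ⟩
  n * k / n   ≤⟨ /-monoˡ-≤ n nk≤m ⟩
  m / n       ∎
  where open ≤-Reasoning

-- The `t` rounds of `suc b` edges exceed `N` by `r`, and only the last round is to feel this. `Q`
-- is an upper estimate of log_2 n. The constants 30 are the margin for finding a playable edge and
-- for allowing components of size 2 from the start.
record Bias (n N : ℕ) : Set where
  field
    b t r Q   : ℕ
    lower     : LowerNLogN 200 n b
    upper     : UpperNLogN 201 n b
    N+r≡      : N + r ≡ t * suc b
    r≤n       : r ≤ n
    30nQ≤b    : 30 * (n * Q) ≤ b
    30tQ≤n    : 30 * (t * Q) ≤ n
    n≤2^Q     : n ≤ 2 ^ Q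
    3≤Q       : 3 ≤ Q

-- Numerals enter as variables. The base of the approximate logarithm is 1 + 1/d, of which between
-- `v` and `d` factors make 2. The threshold n ≥ 2^(q + 1) forces p ≥ d k, and from there on p is
-- small against n.
module _ (d v h k q : ℕ) .{{_ : NonZero d}} .{{_ : NonZero v}}
  (d-doubling : 2 * d ^ d ≤ suc d ^ d) (v-doubling : suc d ^ v ≤ 2 * d ^ v)
  (2d≤5h : 2 * d + 6 ≤ 5 * h) (hdk≤2^k : h * d * suc k ≤ 2 ^ k) (dk<vq : suc (d * k) ≤ v * q)
  (200*5≤d : 200 * 5 ≤ d) (slope : suc d * suc d ≤ 5 * d * 201)
  (offset : suc d * suc d * (d * k + 2) ≤ 5 * d * 201 * (d * k))
  (150≤v : 150 ≤ v) (150q≤vq : 150 * (q + 1) ≤ v * q) (20d≤2^q : 20 * d ≤ 2 ^ suc q) (2≤q : 2 ≤ q)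
  (n N : ℕ) (2^q≤n : 2 ^ suc q ≤ n) (n²≤ : n * n ≤ N + N + n) (N≤n² : N ≤ n * n)
  where

  private
    20d≤n : 20 * d ≤ n
    20d≤n = ≤-trans 20d≤2^q 2^q≤n

    20≤n : 20 ≤ n
    20≤n = ≤-trans (m≤m*n 20 d) 20d≤n

    1≤n : 1 ≤ n
    1≤n = ≤-trans (s≤s z≤n) 20≤n

    10≤n : 10 ≤ n
    10≤n = ≤-trans (m≤m+n 10 10) 20≤n

  bias-from-index : ∀ p → suc d ^ p ≤ n * d ^ p → n * d ^ suc p ≤ suc d ^ suc p → Bias n N
  bias-from-index p ≤n n≤ = from-lengths (round-lengths N c d (>-nonZero⁻¹ d) edges)
    where
    open ≤-Reasoning
    Q c x : ℕ
    Q = suc p / v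
    -- The 5 matches `200 * 5 ≤ d`: as b ≥ c, d b ≥ 200 * 5 c ≥ 200 n (p + 1), which gives the lower
    -- bound on b.
    c = suc (n * suc p / 5)
    x = p / d
    n≤2^Q : n ≤ 2 ^ suc Q
    n≤2^Q = log-index-upper d v n (suc p) (suc Q) v-doubling
      (≤-trans (n≤1+n (suc p)) (m<[1+m/n]*n (suc p) v)) n≤
    q≤Q : q ≤ Q
    q≤Q = ≮⇒≥ λ Q<q → <⇒≱ (^-monoʳ-< 2 (s≤s (s≤s z≤n)) (s≤s Q<q)) (≤-trans 2^q≤n n≤2^Q)
    vQ≤p : v * Q ≤ suc p
    vQ≤p = n*[m/n]≤m (suc p) v
    dk≤p : d * k ≤ p
    dk≤p = s≤s⁻¹ (≤-trans dk<vq (≤-trans (*-monoʳ-≤ v q≤Q) vQ≤p))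
    k≤x : k ≤ x
    k≤x = ≤-/ k p d dk≤p
    hdx≤n : h * d * suc x ≤ n
    hdx≤n = ≤-trans (subst (λ y → h * d * suc y ≤ 2 ^ y) (m+[n∸m]≡n k≤x) (linear≤2^ (h * d) k (x ∸ k) hdk≤2^k))
      (log-index-lower d d n p x d-doubling (n*[m/n]≤m p d) ≤n)
    hp≤n : h * suc p ≤ n
    hp≤n = begin
      h * suc p           ≤⟨ *-monoʳ-≤ h (m<[1+m/n]*n p d) ⟩
      h * (d * suc x)     ≡⟨ *-assoc h d (suc x) ⟨
      h * d * suc x       ≤⟨ hdx≤n ⟩
      n                   ∎
    np≤5c : n * suc p ≤ 5 * c
    np≤5c = <⇒≤ (m<[1+m/n]*n (n * suc p) 5)
    5c≤np : 5 * c ≤ n * suc p + 5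
    5c≤np = begin
      5 * c                         ≡⟨ *-suc 5 (n * suc p / 5) ⟩
      5 + 5 * (n * suc p / 5)       ≤⟨ +-monoʳ-≤ 5 (n*[m/n]≤m (n * suc p) 5) ⟩
      5 + n * suc p                 ≡⟨ +-comm 5 (n * suc p) ⟩
      n * suc p + 5                 ∎
    edges : d * suc c ≤ N
    edges = enough-edges d n (suc p) c N n²≤ 5c≤np 20d≤n (s≤s z≤n) (begin
      (2 * d + 6) * suc p   ≤⟨ *-monoˡ-≤ (suc p) 2d≤5h ⟩
      5 * h * suc p         ≡⟨ *-assoc 5 h (suc p) ⟩
      5 * (h * suc p)       ≤⟨ *-monoʳ-≤ 5 hp≤n ⟩
      5 * n                 ∎)
    from-lengths : (∃ λ t → ∃ λ b → ∃ λ r →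
      N + r ≡ t * suc b × r ≤ t × b * t ≤ N × c ≤ b × d * b ≤ suc d * suc c) → Bias n N
    from-lengths (t , b , r , total , r≤t , bt≤N , c≤b , db≤) = record
      { b = b ; t = t ; r = r ; Q = suc Q
      -- Each neighbouring exponent serves one bound: (1 + 1/d)^(p + 1) is at least n, and (1 +
      -- 1/d)^p at most n.
      ; lower = LowerNLogN-intro d 200 n b (suc p) n≤ lower
      ; upper = UpperNLogN-intro d 201 n b p ≤n
          (upper-condition d 201 n p c b 5c≤np 10≤n db≤
            (≤-trans (affine-≤ (suc d * suc d) (5 * d * 201) 2 slope offset dk≤p)
                     (≤-reflexive (*-assoc (5 * d) 201 p))))
      ; N+r≡ = total
      ; r≤n = ≤-trans r≤t (≤-trans (m≤m*n t (suc Q)) (≤-trans (m≤n*m (t * suc Q) 30) 30tQ≤n))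
      ; 30nQ≤b = 30nQ≤b
      ; 30tQ≤n = 30tQ≤n
      ; n≤2^Q = n≤2^Q
      ; 3≤Q = s≤s (≤-trans 2≤q q≤Q)
      }
      where
      lower : suc p * (200 * n) ≤ d * b
      lower = begin
        suc p * (200 * n)     ≡⟨ regroup (suc p) 200 n ⟩
        200 * (n * suc p)     ≤⟨ *-monoʳ-≤ 200 (≤-trans np≤5c (*-monoʳ-≤ 5 c≤b)) ⟩
        200 * (5 * b)         ≡⟨ *-assoc 200 5 b ⟨
        200 * 5 * b           ≤⟨ *-monoˡ-≤ b 200*5≤d ⟩
        d * b                 ∎
        where
        regroup : ∀ p a n → p * (a * n) ≡ a * (n * p)
        regroup = solve-∀
      30nQ≤b : 30 * (n * suc Q) ≤ b
      30nQ≤b = bias-large v n (suc p) c b Q np≤5c c≤b vQ≤p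
        (subst (λ z → 150 * z ≤ v * Q) (+-comm Q 1) (affine-≤ 150 v 1 150≤v 150q≤vq q≤Q))
      30tQ≤n : 30 * (t * suc Q) ≤ n
      30tQ≤n = few-rounds n b t (suc Q) N 1≤n N≤n² bt≤N 30nQ≤b

  bias-parameters : Bias n N
  bias-parameters =
    let p , ≤n , n≤ = log-index d d n d-doubling (≤-trans (s≤s (s≤s z≤n)) 20≤n)
    in bias-from-index p ≤n n≤

-- With d = 1000 the losses turn 200 into 200 (1001/1000)^2, about 200.4, and for p ≥ 29000 the
-- passage to p + 2 still fits below 201. The least q with 500 q > 29000 is 59.
choose-bias : ∀ n N → 2 ^ 60 ≤ n → n * n ≤ N + N + n → N ≤ n * n → Bias n N
choose-bias = bias-parameters 1000 500 500 29 59 doubling-lower doubling-upper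
  (≤ᵇ⇒≤ (2 * 1000 + 6) (5 * 500) tt)
  (≤ᵇ⇒≤ (500 * 1000 * 30) (2 ^ 29) tt)
  (≤ᵇ⇒≤ (suc (1000 * 29)) (500 * 59) tt)
  (≤ᵇ⇒≤ (200 * 5) 1000 tt)
  (≤ᵇ⇒≤ (1001 * 1001) (5 * 1000 * 201) tt)
  (≤ᵇ⇒≤ (1001 * 1001 * (1000 * 29 + 2)) (5 * 1000 * 201 * (1000 * 29)) tt)
  (≤ᵇ⇒≤ 150 500 tt)
  (≤ᵇ⇒≤ (150 * (59 + 1)) (500 * 59) tt)
  (≤ᵇ⇒≤ (20 * 1000) (2 ^ 60) tt)
  (≤ᵇ⇒≤ 2 59 tt)

-- Counting in lists

length-unique-⊆ : {A : Set} {xs ys : List A} → Unique xs → (∀ {x} → x ∈ xs → x ∈ ys) → length xs ≤ length ys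
length-unique-⊆ {xs = []} _ _ = z≤n
length-unique-⊆ {xs = x ∷ xs} (x≢ ∷ xs!) xs⊆ys with ∈-∃++ (xs⊆ys (here refl))
... | as , bs , refl = begin
  suc (length xs)               ≤⟨ s≤s (length-unique-⊆ xs! rest) ⟩
  suc (length (as ++ bs))       ≡⟨ cong suc (length-++ as) ⟩
  suc (length as + length bs)   ≡⟨ +-suc (length as) (length bs) ⟨
  length as + suc (length bs)   ≡⟨ length-++ as ⟨
  length (as ++ x ∷ bs)         ∎
  where
  open ≤-Reasoning
  rest : ∀ {y} → y ∈ xs → y ∈ as ++ bs
  rest y∈xs with ∈-++⁻ as (xs⊆ys (there y∈xs))
  ... | inj₁ y∈as          = ∈-++⁺ˡ y∈as
  ... | inj₂ (here y≡x)    = contradiction (sym y≡x) (All.lookup x≢ y∈xs)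
  ... | inj₂ (there y∈bs)  = ∈-++⁺ʳ as y∈bs

-- `key` recovers the block an element comes from, which makes different blocks disjoint.
concatMap-unique : {A B : Set} (f : A → List B) (key : B → A) → (∀ {x z} → z ∈ f x → key z ≡ x) →
  (∀ x → Unique (f x)) → ∀ {xs} → Unique xs → Unique (concatMap f xs)
concatMap-unique f key key≡ f! {[]} _ = []
concatMap-unique f key key≡ f! {x ∷ xs} (x≢ ∷ xs!) =
  Unique.++⁺ (f! x) (concatMap-unique f key key≡ f! xs!) disjoint
  where
  disjoint : ∀ {z} → ¬ (z ∈ f x × z ∈ concatMap f xs)
  disjoint (z∈fx , z∈rest) with find (∈-concatMap⁻ f {xs = xs} z∈rest)
  ... | y , y∈xs , z∈fy = All.lookup x≢ y∈xs (trans (sym (key≡ z∈fx)) (key≡ z∈fy))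

-- `C` acts as a denominator: D / C bounds each block without division.
length-concatMap-≤ : {A B : Set} (f : A → List B) (C D : ℕ) (xs : List A) →
  (∀ {x} → x ∈ xs → length (f x) * C ≤ D) → length (concatMap f xs) * C ≤ length xs * D
length-concatMap-≤ f C D [] _ = z≤n
length-concatMap-≤ f C D (x ∷ xs) bound = begin
  length (f x ++ concatMap f xs) * C                ≡⟨ cong (_* C) (length-++ (f x)) ⟩
  (length (f x) + length (concatMap f xs)) * C      ≡⟨ *-distribʳ-+ C (length (f x)) _ ⟩
  length (f x) * C + length (concatMap f xs) * C    ≤⟨ +-mono-≤ (bound (here refl)) (length-concatMap-≤ f C D xs (bound ∘ there)) ⟩
  D + length xs * D                                 ∎
  where open ≤-Reasoning

length-allFin : ∀ n → length (allFin n) ≡ n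
length-allFin n = length-tabulate id

length-cartesianProduct : {A B : Set} (xs : List A) (ys : List B) →
  length (cartesianProduct xs ys) ≡ length xs * length ys
length-cartesianProduct [] ys = refl
length-cartesianProduct (x ∷ xs) ys = trans (length-++ (map (x ,_) ys))
  (cong₂ _+_ (length-map (x ,_) ys) (length-cartesianProduct xs ys))

allEdges-row : ∀ {n} → Fin n → Fin n → List (Edge n)
allEdges-row i j = if toℕ i <ᵇ toℕ j then [ (i , j) ] else []

∈-allEdges-row : ∀ {n} (i j : Fin n) {e} → e ∈ allEdges-row i j → e ≡ (i , j)
∈-allEdges-row i j e∈ with toℕ i <ᵇ toℕ j | e∈
... | true | here e≡ = e≡

allEdges-unique : ∀ n → Unique (allEdges n)
allEdges-unique n = concatMap-unique _ proj₁ fst≡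
  (λ i → concatMap-unique (allEdges-row i) proj₂ (λ {j} e∈ → cong proj₂ (∈-allEdges-row i j e∈))
    (row-unique i) (Unique.allFin⁺ n))
  (Unique.allFin⁺ n)
  where
  fst≡ : ∀ {i e} → e ∈ concatMap (allEdges-row i) (allFin n) → proj₁ e ≡ i
  fst≡ {i} e∈ with find (∈-concatMap⁻ (allEdges-row i) {xs = allFin n} e∈)
  ... | j , _ , e∈row = cong proj₁ (∈-allEdges-row i j e∈row)
  row-unique : ∀ i j → Unique (allEdges-row {n} i j)
  row-unique i j with toℕ i <ᵇ toℕ j
  ... | true  = [] ∷ []
  ... | false = []

∈-allEdges : ∀ {n} {i j : Fin n} → toℕ i < toℕ j → (i , j) ∈ allEdges n
∈-allEdges {n} {i} {j} i<j =
  ∈-concatMap⁺ _ (lose (∈-allFin i) (∈-concatMap⁺ (allEdges-row i) (lose (∈-allFin j) in-row)))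
  where
  in-row : (i , j) ∈ allEdges-row i j
  in-row with toℕ i <ᵇ toℕ j | <⇒<ᵇ i<j
  ... | true | _ = here refl

length-allEdges-upper : ∀ n → length (allEdges n) ≤ n * n
length-allEdges-upper n = begin
  length (allEdges n)                               ≤⟨ length-unique-⊆ (allEdges-unique n) (λ _ → ∈-cartesianProduct⁺ (∈-allFin _) (∈-allFin _)) ⟩
  length (cartesianProduct (allFin n) (allFin n))   ≡⟨ length-cartesianProduct (allFin n) (allFin n) ⟩
  length (allFin n) * length (allFin n)             ≡⟨ cong₂ _*_ (length-allFin n) (length-allFin n) ⟩
  n * n                                             ∎
  where open ≤-Reasoning

-- Every ordered pair is an edge, a reversed edge or a diagonal pair.
length-allEdges-lower : ∀ n → n * n ≤ length (allEdges n) + length (allEdges n) + n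
length-allEdges-lower n = begin
  n * n                                             ≡⟨ cong₂ _*_ (length-allFin n) (length-allFin n) ⟨
  length (allFin n) * length (allFin n)             ≡⟨ length-cartesianProduct (allFin n) (allFin n) ⟨
  length (cartesianProduct (allFin n) (allFin n))
    ≤⟨ length-unique-⊆ (Unique.cartesianProduct⁺ (Unique.allFin⁺ n) (Unique.allFin⁺ n)) (λ _ → cover _) ⟩
  length ((es ++ map swap es) ++ map (λ i → i , i) (allFin n)) ≡⟨ length-++ (es ++ map swap es) ⟩
  length (es ++ map swap es) + length (map (λ i → i , i) (allFin n))
    ≡⟨ cong₂ _+_ (trans (length-++ es) (cong (length es +_) (length-map swap es)))
                 (trans (length-map _ (allFin n)) (length-allFin n)) ⟩
  length es + length es + n                         ∎
  where
  open ≤-Reasoning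
  es = allEdges n
  cover : ∀ e → e ∈ (es ++ map swap es) ++ map (λ i → i , i) (allFin n)
  cover (i , j) with Fin.<-cmp i j
  ... | tri< i<j _ _ = ∈-++⁺ˡ (∈-++⁺ˡ (∈-allEdges i<j))
  ... | tri≈ _ refl _ = ∈-++⁺ʳ (es ++ map swap es) (∈-map⁺ (λ i → i , i) (∈-allFin i))
  ... | tri> _ _ j<i = ∈-++⁺ˡ (∈-++⁺ʳ es (∈-map⁺ swap (∈-allEdges j<i)))

-- Adding an edge to a forest

Forest-[] : ∀ {n} → Forest {n} []
Forest-[] (_ , _ , _ , _ , _ , _ , inj₁ ())
Forest-[] (_ , _ , _ , _ , _ , _ , inj₂ ())

-- Label classes are then unions of components, so distinct labels certify distinct components.
Respects : ∀ {n} → (Fin n → Fin n) → List (Edge n) → Set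
Respects c A = ∀ {u v} → (u , v) ∈ A → c u ≡ c v

module _ {n : ℕ} {A : List (Edge n)} (c : Fin n → Fin n) (respects : Respects c A)
  (a b : Fin n) (ca≢cb : c a ≢ c b) where

  private
    A⁺ : List (Edge n)
    A⁺ = (a , b) ∷ A

    New : Fin n → Fin n → Set
    New u v = (u ≡ a × v ≡ b) ⊎ (u ≡ b × v ≡ a)

    New-label : ∀ {u v} → New u v → c u ≢ c v
    New-label (inj₁ (refl , refl)) = ca≢cb
    New-label (inj₂ (refl , refl)) = ca≢cb ∘ sym

    Adj-label : ∀ {u v} → Adj A u v → c u ≡ c v
    Adj-label (inj₁ uv∈A) = respects uv∈A
    Adj-label (inj₂ vu∈A) = sym (respects vu∈A)

    Adj⁺-cases : ∀ {u v} → Adj A⁺ u v → Adj A u v ⊎ New u v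
    Adj⁺-cases (inj₁ (here refl))   = inj₂ (inj₁ (refl , refl))
    Adj⁺-cases (inj₁ (there uv∈A))  = inj₁ (inj₁ uv∈A)
    Adj⁺-cases (inj₂ (here refl))   = inj₂ (inj₂ (refl , refl))
    Adj⁺-cases (inj₂ (there vu∈A))  = inj₁ (inj₂ vu∈A)

    New-meets : ∀ {p q u v} → New p q → New u v → (p ≡ u × q ≡ v) ⊎ (p ≡ v × q ≡ u)
    New-meets (inj₁ (refl , refl)) (inj₁ (refl , refl)) = inj₁ (refl , refl)
    New-meets (inj₁ (refl , refl)) (inj₂ (refl , refl)) = inj₂ (refl , refl)
    New-meets (inj₂ (refl , refl)) (inj₁ (refl , refl)) = inj₂ (refl , refl)
    New-meets (inj₂ (refl , refl)) (inj₂ (refl , refl)) = inj₁ (refl , refl)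

    next : List (Fin n) → Fin n → Fin n
    next []      w = w
    next (y ∷ _) w = y

    -- Using the new edge would visit both its ends, so a walk missing the end `p` follows old edges
    -- within one label.
    avoiding-walk-label : ∀ {p q} → New p q → ∀ x ws w → Linked (Adj A⁺) (x ∷ ws ++ [ w ]) →
      p ∉ x ∷ ws ++ [ w ] → c w ≡ c x
    avoiding-walk-label pq x [] w (xw ∷ _) p∉ with Adj⁺-cases xw
    ... | inj₁ old = sym (Adj-label old)
    ... | inj₂ new with New-meets pq new
    ... | inj₁ (refl , _) = contradiction (here refl) p∉
    ... | inj₂ (refl , _) = contradiction (there (here refl)) p∉
    avoiding-walk-label pq x (y ∷ ws) w (xy ∷ walk) p∉ with Adj⁺-cases xy
    ... | inj₁ old = trans (avoiding-walk-label pq y ws w walk (p∉ ∘ there)) (sym (Adj-label old))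
    ... | inj₂ new with New-meets pq new
    ... | inj₁ (refl , _) = contradiction (here refl) p∉
    ... | inj₂ (refl , _) = contradiction (there (here refl)) p∉

    -- The new edge is traversed from `p` to `q`. The last clause says that a crossing from the
    -- start `x` uses the first edge of the walk; this later rules out closing a cycle by the same
    -- edge.
    Crossing : Fin n → List (Fin n) → Fin n → Set
    Crossing x ws w = ∃ λ p → ∃ λ q →
      New p q × c x ≡ c p × c w ≡ c q × p ∈ x ∷ ws ++ [ w ] × (x ≡ p → next ws w ≡ q)

    -- A path visits `p` only once, so after the crossing it cannot use the new edge again and ends
    -- in the label of `q`.
    walk-cases : ∀ x ws w → Linked (Adj A⁺) (x ∷ ws ++ [ w ]) → Unique (x ∷ ws ++ [ w ]) →
      (Linked (Adj A) (x ∷ ws ++ [ w ]) × c w ≡ c x) ⊎ Crossing x ws w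
    walk-cases x [] w (xw ∷ _) _ with Adj⁺-cases xw
    ... | inj₁ old = inj₁ (old ∷ [-] , sym (Adj-label old))
    ... | inj₂ new = inj₂ (x , w , new , refl , refl , here refl , λ _ → refl)
    walk-cases x (y ∷ ws) w (xy ∷ walk) unique@(_ ∷ unique′) with Adj⁺-cases xy
    ... | inj₂ new = inj₂ (x , y , new , refl ,
            avoiding-walk-label new y ws w walk (Unique[x∷xs]⇒x∉xs unique) , here refl , λ _ → refl)
    ... | inj₁ old with walk-cases y ws w walk unique′
    ... | inj₁ (walk′ , cw≡cy) = inj₁ (old ∷ walk′ , trans cw≡cy (sym (Adj-label old)))
    ... | inj₂ (p , q , new , cy≡cp , cw≡cq , p∈ , _) = inj₂ (p , q , new ,
            trans (Adj-label old) cy≡cp , cw≡cq , there p∈ ,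
            λ { refl → contradiction p∈ (Unique[x∷xs]⇒x∉xs unique) })

  -- Labels are constant along old edges, so a cycle through the new edge would have to
  -- cross between the labels of its endpoints twice, using that edge twice.
  Forest-∷ : Forest A → Forest ((a , b) ∷ A)
  Forest-∷ forest (v , ws , w , 1≤ws , unique , walk , wv)
    with walk-cases v ws w walk unique | Adj⁺-cases wv
  ... | inj₁ (walk′ , _)      | inj₁ old = forest (v , ws , w , 1≤ws , unique , walk′ , old)
  ... | inj₁ (_ , cw≡cv)      | inj₂ new = New-label new cw≡cv
  ... | inj₂ (p , q , pq , cv≡cp , cw≡cq , _) | inj₁ old =
        New-label pq (trans (sym cv≡cp) (trans (sym (Adj-label old)) cw≡cq))
  ... | inj₂ (p , q , pq , cv≡cp , cw≡cq , _ , first) | inj₂ new with New-meets pq new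
  ...   | inj₁ (refl , refl) = New-label new (sym cv≡cp)
  -- The closing edge is the crossing run backwards, so `w` would directly follow `v`, although the
  -- nonempty `ws` lies between them.
  ...   | inj₂ (refl , refl) with ws | 1≤ws | unique | first refl
  ...     | y ∷ ws′ | _ | _ ∷ (y≢ ∷ _) | y≡w = All.lookup y≢ (∈-++⁺ʳ ws′ (here refl)) y≡w

-- Component sizes

-- A labelling c : Fin n → Fin n describes the partition of the vertices into
-- the components of Avoider's graph.
class : ∀ {n} → (Fin n → Fin n) → Fin n → List (Fin n)
class {n} c ℓ = filter (λ y → c y ≟ ℓ) (allFin n)

size : ∀ {n} → (Fin n → Fin n) → Fin n → ℕ
size c x = length (class c (c x))

large : ∀ {n} → (Fin n → Fin n) → ℕ → List (Fin n)
large {n} c q = filter (λ x → q ≤? size c x) (allFin n)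

∈-class : ∀ {n} (c : Fin n → Fin n) {ℓ x} → c x ≡ ℓ → x ∈ class c ℓ
∈-class c cx≡ = ∈-filter⁺ (λ y → c y ≟ _) (∈-allFin _) cx≡

∈-class⁻ : ∀ {n} (c : Fin n → Fin n) {ℓ x} → x ∈ class c ℓ → c x ≡ ℓ
∈-class⁻ {n} c x∈ = proj₂ (∈-filter⁻ (λ y → c y ≟ _) {xs = allFin n} x∈)

class-unique : ∀ {n} (c : Fin n → Fin n) ℓ → Unique (class c ℓ)
class-unique {n} c ℓ = Unique.filter⁺ _ (Unique.allFin⁺ n)

∈-large : ∀ {n} (c : Fin n → Fin n) {q x} → q ≤ size c x → x ∈ large c q
∈-large c q≤ = ∈-filter⁺ (λ x → _ ≤? size c x) (∈-allFin _) q≤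

∈-large⁻ : ∀ {n} (c : Fin n → Fin n) {q x} → x ∈ large c q → q ≤ size c x
∈-large⁻ {n} c x∈ = proj₂ (∈-filter⁻ (λ x → _ ≤? size c x) {xs = allFin n} x∈)

large-unique : ∀ {n} (c : Fin n → Fin n) q → Unique (large c q)
large-unique {n} c q = Unique.filter⁺ _ (Unique.allFin⁺ n)

large-empty : ∀ {n} (c : Fin n → Fin n) q → length (large c q) ≡ 0 → ∀ x → size c x < q
large-empty c q empty x = ≰⇒> λ q≤ → nonempty (∈-large c q≤) empty
  where
  nonempty : ∀ {n} {x : Fin n} {xs} → x ∈ xs → length xs ≢ 0
  nonempty (here _)  ()
  nonempty (there _) ()

large-id : ∀ n q → 2 ≤ q → length (large {n} id q) ≡ 0
large-id n q 2≤q = n≤0⇒n≡0 (length-unique-⊆ {ys = []} (large-unique id q) absurd)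
  where
  absurd : ∀ {x} → x ∈ large {n} id q → x ∈ []
  absurd {x} x∈ = contradiction (≤-trans 2≤q (∈-large⁻ id x∈))
    (<⇒≱ (s≤s (length-unique-⊆ {ys = [ x ]} (class-unique id x) (λ y∈ → here (∈-class⁻ id y∈)))))

relabel : ∀ {n} → Fin n → Fin n → Fin n → Fin n
relabel i j z with z ≟ j
... | yes _ = i
... | no  _ = z

relabel-source : ∀ {n} (i j : Fin n) → relabel i j j ≡ i
relabel-source i j with j ≟ j
... | yes _  = refl
... | no j≢j = contradiction refl j≢j

relabel-target : ∀ {n} (i j : Fin n) → relabel i j i ≡ i
relabel-target i j with i ≟ j
... | yes _ = refl
... | no  _ = refl

relabel-cases : ∀ {n} (i j z : Fin n) → (z ≡ j × relabel i j z ≡ i) ⊎ (relabel i j z ≡ z)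
relabel-cases i j z with z ≟ j
... | yes z≡j = inj₁ (z≡j , refl)
... | no  _   = inj₂ refl

module _ {n : ℕ} (c : Fin n → Fin n) (a b : Fin n) where

  merge : Fin n → Fin n
  merge = relabel (c a) (c b) ∘ c

  private
    merged-size : ∀ x → merge x ≡ c a → size merge x ≤ size c a + size c b
    merged-size x eq = begin
      length (class merge (merge x))          ≤⟨ length-unique-⊆ (class-unique merge (merge x)) incl ⟩
      length (class c (c a) ++ class c (c b)) ≡⟨ length-++ (class c (c a)) ⟩
      size c a + size c b                     ∎
      where
      open ≤-Reasoning
      incl : ∀ {y} → y ∈ class merge (merge x) → y ∈ class c (c a) ++ class c (c b)
      incl {y} y∈ with relabel-cases (c a) (c b) (c y)
      ... | inj₁ (cy≡cb , _) = ∈-++⁺ʳ (class c (c a)) (∈-class c cy≡cb)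
      ... | inj₂ same = ∈-++⁺ˡ (∈-class c (trans (sym same) (trans (∈-class⁻ merge y∈) eq)))

    unmerged-size : ∀ x → merge x ≢ c a → size merge x ≤ size c x
    unmerged-size x neq = length-unique-⊆ (class-unique merge (merge x)) incl
      where
      unchanged : ∀ y → merge y ≢ c a → merge y ≡ c y
      unchanged y neq with relabel-cases (c a) (c b) (c y)
      ... | inj₁ (_ , eq) = contradiction eq neq
      ... | inj₂ same = same
      incl : ∀ {y} → y ∈ class merge (merge x) → y ∈ class c (c x)
      incl {y} y∈ = ∈-class c (trans (sym (unchanged y (neq ∘ trans (sym y~x)))) (trans y~x (unchanged x neq)))
        where y~x = ∈-class⁻ merge y∈

  -- Only the merged class gains vertices, and it stays below `q`.
  large-merge-bounded : ∀ q → size c a + size c b < q → length (large merge q) ≤ length (large c q)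
  large-merge-bounded q small = length-unique-⊆ (large-unique merge q) incl
    where
    incl : ∀ {x} → x ∈ large merge q → x ∈ large c q
    incl {x} x∈ with merge x ≟ c a
    ... | yes eq = contradiction (≤-trans (∈-large⁻ merge x∈) (merged-size x eq)) (<⇒≱ small)
    ... | no neq = ∈-large c (≤-trans (∈-large⁻ merge x∈) (unmerged-size x neq))

  -- A newly large vertex lay in one of the two merged classes, and that class had fewer than `q`
  -- vertices.
  large-merge : ∀ q → length (large merge q) ≤ length (large c q) + (q + q)
  large-merge q = begin
    length (large merge q)                    ≤⟨ length-unique-⊆ (large-unique merge q) incl ⟩
    length (large c q ++ (new a ++ new b))    ≡⟨ trans (length-++ (large c q)) (cong (length (large c q) +_) (length-++ (new a))) ⟩
    length (large c q) + (length (new a) + length (new b)) ≤⟨ +-monoʳ-≤ (length (large c q)) (+-mono-≤ (new-length a) (new-length b)) ⟩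
    length (large c q) + (q + q)              ∎
    where
    open ≤-Reasoning
    -- A class above `q` was large before and adds nothing, so each of the two contributes at most
    -- `q`.
    new : Fin n → List (Fin n)
    new x with size c x ≤? q
    ... | yes _ = class c (c x)
    ... | no  _ = []
    new-length : ∀ x → length (new x) ≤ q
    new-length x with size c x ≤? q
    ... | yes ≤q = ≤q
    ... | no  _  = z≤n
    ∈-new : ∀ {x y} → c x ≡ c y → x ∉ large c q → x ∈ new y
    ∈-new {x} {y} cx≡cy x∉ with size c y ≤? q
    ... | yes _ = ∈-class c cx≡cy
    ... | no ≰q = contradiction (∈-large c (≤-trans (<⇒≤ (≰⇒> ≰q)) (≤-reflexive (cong (length ∘ class c) (sym cx≡cy))))) x∉
    incl : ∀ {x} → x ∈ large merge q → x ∈ large c q ++ (new a ++ new b)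
    incl {x} x∈ with q ≤? size c x
    ... | yes q≤ = ∈-++⁺ˡ (∈-large c q≤)
    ... | no q≰ with relabel-cases (c a) (c b) (c x) | merge x ≟ c a
    ...   | inj₁ (cx≡cb , _) | _ = ∈-++⁺ʳ (large c q) (∈-++⁺ʳ (new a) (∈-new cx≡cb (q≰ ∘ ∈-large⁻ c)))
    ...   | inj₂ same | yes eq = ∈-++⁺ʳ (large c q) (∈-++⁺ˡ (∈-new (trans (sym same) eq) (q≰ ∘ ∈-large⁻ c)))
    ...   | inj₂ same | no neq = contradiction (≤-trans (∈-large⁻ merge x∈) (unmerged-size x neq)) q≰

-- Counting the pairs that Avoider must not join

Free : ∀ {n} → (Fin n → Fin n) → ℕ → Edge n → Set
Free c q (u , v) = c u ≢ c v × size c u + size c v < q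

free? : ∀ {n} (c : Fin n → Fin n) q e → Dec (Free c q e)
free? c q (u , v) = ¬? (c u ≟ c v) ×-dec (size c u + size c v <? q)

module _ {n : ℕ} (c : Fin n → Fin n) where

  private
    V : List (Fin n)
    V = allFin n

  -- A superset of the pairs (u , v) that lie in a common class or have size sum above q:
  -- if both sizes are below q, the index j with 2 + j = size u covers the pair.
  blocked : ℕ → List (Edge n)
  blocked q =
    concatMap (λ u → map (u ,_) (class c (c u))) V ++
    (cartesianProduct V (large c q) ++
    (cartesianProduct (large c q) V ++
     concatMap (λ j → cartesianProduct (large c (2 + j)) (large c (q ∸ suc j))) (upTo (q ∸ 2))))

  ∈-blocked : ∀ q e → ¬ Free c (suc q) e → e ∈ blocked q
  ∈-blocked q (u , v) ¬free with c u ≟ c v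
  ... | yes cu≡cv = ∈-++⁺ˡ (∈-concatMap⁺ _ (lose (∈-allFin u) (∈-map⁺ (u ,_) (∈-class c (sym cu≡cv)))))
  ... | no cu≢cv with q ≤? size c v | q ≤? size c u
  ... | yes q≤v | _ = ∈-++⁺ʳ (concatMap _ V) (∈-++⁺ˡ (∈-cartesianProduct⁺ (∈-allFin u) (∈-large c q≤v)))
  ... | no _ | yes q≤u = ∈-++⁺ʳ (concatMap _ V) (∈-++⁺ʳ (cartesianProduct V (large c q))
          (∈-++⁺ˡ (∈-cartesianProduct⁺ (∈-large c q≤u) (∈-allFin v))))
  ... | no v<q | no u<q = ∈-++⁺ʳ (concatMap _ V) (∈-++⁺ʳ (cartesianProduct V (large c q))
          (∈-++⁺ʳ (cartesianProduct (large c q) V)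
            (∈-concatMap⁺ _ (lose (∈-upTo⁺ j<) (∈-cartesianProduct⁺ (∈-large c (≤-reflexive su≡)) (∈-large c v≥))))))
    where
    su sv j : ℕ
    su = size c u
    sv = size c v
    j = su ∸ 2
    sum : suc q ≤ su + sv
    sum = ≮⇒≥ λ sum< → ¬free (cu≢cv , sum<)
    -- From sv < q and su + sv > q follows su ≥ 2; together with su < q this gives j < q - 2.
    2≤su : 2 ≤ su
    2≤su = +-cancelʳ-≤ q 2 su (≤-trans (s≤s sum) (≤-trans (≤-reflexive (sym (+-suc su sv))) (+-monoʳ-≤ su (≰⇒> v<q))))
    su≡ : 2 + j ≡ su
    su≡ = m+[n∸m]≡n 2≤su
    j< : j < q ∸ 2
    j< = ∸-monoˡ-< (≰⇒> u<q) 2≤su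
    v≥ : q ∸ suc j ≤ sv
    v≥ = m≤n+o⇒m∸n≤o q (suc j) (s≤s⁻¹ (≤-trans sum (≤-reflexive (cong (_+ sv) (sym su≡)))))

  free-edge : ∀ {U} q → Unique U → length (blocked q) < length U → ∃ λ e → e ∈ U × Free c (suc q) e
  free-edge {U} q U! short with any? (free? c (suc q)) U
  ... | yes free = find free
  ... | no ¬free = contradiction
        (length-unique-⊆ U! λ {e} e∈ → ∈-blocked q e (λ f → ¬free (lose e∈ f)))
        (<⇒≱ short)

module _ {n : ℕ} (c : Fin n → Fin n) (Q : ℕ) (sizes<Q : ∀ x → size c x < Q)
  (few-large : ∀ i → 2 ≤ i → i ≤ Q → length (large c i) * (Q * 2 ^ i) ≤ 8 * n) where

  private
    V : List (Fin n)
    V = allFin n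

    -- The thresholds add up to q + 1, so the powers of 2 combine to the same 2^(q + 1) for every
    -- `j`. Of the two factors `Q`, one pays for summing over at most `Q` values of `j`, the other
    -- survives in the final bound.
    product-few : ∀ q j → 2 ≤ q → q ≤ Q → j < q ∸ 2 →
      length (cartesianProduct (large c (2 + j)) (large c (q ∸ suc j))) * (Q * 2 ^ suc q * Q) ≤ 64 * (n * n)
    product-few q j 2≤q q≤Q j< = begin
      length (cartesianProduct (large c i₁) (large c i₂)) * (Q * 2 ^ suc q * Q)
        ≡⟨ cong₂ (λ l e → l * (Q * 2 ^ e * Q)) (length-cartesianProduct (large c i₁) (large c i₂)) (sym i₁+i₂) ⟩
      x₁ * x₂ * (Q * 2 ^ (i₁ + i₂) * Q)
        ≡⟨ cong (λ e → x₁ * x₂ * (Q * e * Q)) (^-distribˡ-+-* 2 i₁ i₂) ⟩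
      x₁ * x₂ * (Q * (2 ^ i₁ * 2 ^ i₂) * Q)
        ≡⟨ regroup x₁ x₂ Q (2 ^ i₁) (2 ^ i₂) ⟩
      (x₁ * (Q * 2 ^ i₁)) * (x₂ * (Q * 2 ^ i₂))
        ≤⟨ *-mono-≤ (few-large i₁ (m≤m+n 2 j) (≤-trans (n≤1+n i₁) (≤-trans 3+j≤q q≤Q)))
                    (few-large i₂ 2≤i₂ (≤-trans (m∸n≤m q (suc j)) q≤Q)) ⟩
      8 * n * (8 * n)
        ≡⟨ regroup′ n ⟩
      64 * (n * n) ∎
      where
      open ≤-Reasoning
      i₁ i₂ x₁ x₂ : ℕ
      i₁ = 2 + j
      i₂ = q ∸ suc j
      x₁ = length (large c i₁)
      x₂ = length (large c i₂)
      3+j≤q : suc i₁ ≤ q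
      3+j≤q = ≤-trans (≤-reflexive (+-comm 2 (suc j))) (m≤o∸n⇒m+n≤o (suc j) 2≤q j<)
      i₁+i₂ : i₁ + i₂ ≡ suc q
      i₁+i₂ = cong suc (m+[n∸m]≡n (≤-trans (m≤n+m (suc j) 2) 3+j≤q))
      2≤i₂ : 2 ≤ i₂
      2≤i₂ = m+n≤o⇒m≤o∸n 2 3+j≤q
      regroup : ∀ x y Q a b → x * y * (Q * (a * b) * Q) ≡ (x * (Q * a)) * (y * (Q * b))
      regroup = solve-∀
      regroup′ : ∀ n → 8 * n * (8 * n) ≡ 64 * (n * n)
      regroup′ = solve-∀

  blocked-few : ∀ q → 2 ≤ q → q ≤ Q → ∃ λ X →
    length (blocked c q) ≤ n * Q + X × X * (Q * 2 ^ suc q) ≤ 96 * (n * n)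
  blocked-few q 2≤q q≤Q = X , bound , X-bound
    where
    open ≤-Reasoning
    same : List (Edge n)
    same = concatMap (λ u → map (u ,_) (class c (c u))) V
    middle : List (Edge n)
    middle = concatMap (λ j → cartesianProduct (large c (2 + j)) (large c (q ∸ suc j))) (upTo (q ∸ 2))
    x y X : ℕ
    x = length (large c q)
    y = length middle
    X = n * x + (x * n + y)
    instance
      Q≢0 : NonZero Q
      Q≢0 = >-nonZero (≤-trans (s≤s z≤n) (≤-trans 2≤q q≤Q))
    same-few : length same ≤ n * Q
    same-few = begin
      length same         ≡⟨ *-identityʳ (length same) ⟨
      length same * 1     ≤⟨ length-concatMap-≤ _ 1 Q V (λ {u} _ → ≤-trans
                               (≤-reflexive (trans (*-identityʳ _) (length-map (u ,_) (class c (c u))))) (<⇒≤ (sizes<Q u))) ⟩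
      length V * Q        ≡⟨ cong (_* Q) (length-allFin n) ⟩
      n * Q               ∎
    bound : length (blocked c q) ≤ n * Q + X
    bound = begin
      length (blocked c q)
        ≡⟨ length-++ same ⟩
      length same + length (cartesianProduct V (large c q) ++ (cartesianProduct (large c q) V ++ middle))
        ≡⟨ cong (length same +_) (trans (length-++ (cartesianProduct V (large c q)))
             (cong₂ _+_ (product₁) (trans (length-++ (cartesianProduct (large c q) V)) (cong (_+ y) product₂)))) ⟩
      length same + X     ≤⟨ +-monoˡ-≤ X same-few ⟩
      n * Q + X           ∎
      where
      product₁ : length (cartesianProduct V (large c q)) ≡ n * x
      product₁ = trans (length-cartesianProduct V (large c q)) (cong (_* x) (length-allFin n))
      product₂ : length (cartesianProduct (large c q) V) ≡ x * n
      product₂ = trans (length-cartesianProduct (large c q) V) (cong (x *_) (length-allFin n))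
    y-bound : y * (Q * 2 ^ suc q) ≤ 64 * (n * n)
    y-bound = *-cancelʳ-≤ _ _ Q (begin
      y * (Q * 2 ^ suc q) * Q           ≡⟨ *-assoc y (Q * 2 ^ suc q) Q ⟩
      y * (Q * 2 ^ suc q * Q)
        ≤⟨ length-concatMap-≤ _ (Q * 2 ^ suc q * Q) (64 * (n * n)) (upTo (q ∸ 2)) (λ {j} j∈ → product-few q j 2≤q q≤Q (∈-upTo⁻ j∈)) ⟩
      length (upTo (q ∸ 2)) * (64 * (n * n)) ≡⟨ cong (_* (64 * (n * n))) (length-upTo (q ∸ 2)) ⟩
      (q ∸ 2) * (64 * (n * n))          ≤⟨ *-monoˡ-≤ (64 * (n * n)) (≤-trans (m∸n≤m q 2) q≤Q) ⟩
      Q * (64 * (n * n))                ≡⟨ *-comm Q (64 * (n * n)) ⟩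
      64 * (n * n) * Q                  ∎)
    -- The two products with all vertices contribute 32 n^2 together, the middle sum 64 n^2.
    X-bound : X * (Q * 2 ^ suc q) ≤ 96 * (n * n)
    X-bound = begin
      (n * x + (x * n + y)) * (Q * (2 * 2 ^ q))
        ≡⟨ regroup n x y Q (2 ^ q) ⟩
      4 * n * (x * (Q * 2 ^ q)) + y * (Q * (2 * 2 ^ q))
        ≤⟨ +-mono-≤ (*-monoʳ-≤ (4 * n) (few-large q 2≤q q≤Q)) y-bound ⟩
      4 * n * (8 * n) + 64 * (n * n)
        ≡⟨ regroup′ n ⟩
      96 * (n * n) ∎
      where
      regroup : ∀ n x y Q w → (n * x + (x * n + y)) * (Q * (2 * w)) ≡ 4 * n * (x * (Q * w)) + y * (Q * (2 * w))
      regroup = solve-∀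
      regroup′ : ∀ n → 4 * n * (8 * n) + 64 * (n * n) ≡ 96 * (n * n)
      regroup′ = solve-∀

-- About 30 n Q k edges remain. Pairs within classes and the shortfall `r` cost at most n Q k each,
-- so failure needs X ≥ 28 n Q k; by the last hypothesis and q ≤ Q this makes X Q 2^q exceed 112
-- n^2.
enough-room : ∀ n Q q b r k L X → 1 ≤ n → 1 ≤ k → 1 ≤ Q → q ≤ Q → r ≤ n → 30 * (n * Q) ≤ b →
  L + r ≡ k * suc b → X * (Q * 2 ^ q) ≤ 96 * (n * n) → 4 * n < k * (q * (Q * 2 ^ q)) → n * Q + X < L
enough-room n Q q b r k L X 1≤n 1≤k 1≤Q q≤Q r≤n ≤b L+r≡ X≤ <k =
  ≰⇒> λ L≤ → <⇒≱ contra (≤-trans (*-monoˡ-≤ W (28nQk≤X L≤)) X≤)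
  where
  open ≤-Reasoning
  W = Q * 2 ^ q
  n≤nQk : n ≤ n * Q * k
  n≤nQk = ≤-trans (m≤m*n n Q {{>-nonZero 1≤Q}}) (m≤m*n (n * Q) k {{>-nonZero 1≤k}})
  28nQk≤X : L ≤ n * Q + X → 28 * (n * Q * k) ≤ X
  28nQk≤X L≤ = +-cancelˡ-≤ (2 * (n * Q * k)) _ _ (begin
    2 * (n * Q * k) + 28 * (n * Q * k)    ≡⟨ regroup (n * Q) k ⟩
    k * (30 * (n * Q))                    ≤⟨ *-monoʳ-≤ k (≤-trans ≤b (n≤1+n b)) ⟩
    k * suc b                             ≡⟨ L+r≡ ⟨
    L + r                                 ≤⟨ +-mono-≤ L≤ (≤-trans r≤n n≤nQk) ⟩
    n * Q + X + n * Q * k                 ≤⟨ +-monoˡ-≤ (n * Q * k) (+-monoˡ-≤ X (m≤m*n (n * Q) k {{>-nonZero 1≤k}})) ⟩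
    n * Q * k + X + n * Q * k             ≡⟨ regroup′ (n * Q * k) X ⟩
    2 * (n * Q * k) + X                   ∎)
    where
    regroup : ∀ a k → 2 * (a * k) + 28 * (a * k) ≡ k * (30 * a)
    regroup = solve-∀
    regroup′ : ∀ a x → a + x + a ≡ 2 * a + x
    regroup′ = solve-∀
  contra : 96 * (n * n) < 28 * (n * Q * k) * W
  contra = begin-strict
    96 * (n * n)                    ≤⟨ *-monoˡ-≤ (n * n) (m≤m+n 96 16) ⟩
    112 * (n * n)                   ≡⟨ regroup n ⟩
    28 * n * (4 * n)                <⟨ *-monoʳ-< (28 * n) {{m*n≢0 28 n {{_}} {{>-nonZero 1≤n}}}} <k ⟩
    28 * n * (k * (q * W))          ≤⟨ *-monoʳ-≤ (28 * n) (*-monoʳ-≤ k (*-monoˡ-≤ W q≤Q)) ⟩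
    28 * n * (k * (Q * W))          ≡⟨ regroup′ n k Q W ⟩
    28 * (n * Q * k) * W            ∎
    where
    regroup : ∀ n → 112 * (n * n) ≡ 28 * n * (4 * n)
    regroup = solve-∀
    regroup′ : ∀ n k Q W → 28 * n * (k * (Q * W)) ≡ 28 * (n * Q * k) * W
    regroup′ = solve-∀

-- Control of the large components over the remaining rounds

module _ (n Q : ℕ) where

  -- q k Q 2^q ≤ 4 n is the condition for Avoider to create components of size q or
  -- more when k rounds remain; each such move adds at most 2 q vertices to x.
  Controlled : ℕ → ℕ → ℕ → Set
  Controlled q k x = x ≡ 0 ⊎ (x + 2 * q * k) * (Q * 2 ^ q) ≤ 8 * n

  controlled-step : ∀ q k {x y} → Controlled q (suc k) x → y ≤ x → Controlled q k y
  controlled-step q k (inj₁ refl) y≤ = inj₁ (n≤0⇒n≡0 y≤)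
  controlled-step q k (inj₂ le) y≤ =
    inj₂ (≤-trans (*-monoˡ-≤ (Q * 2 ^ q) (+-mono-≤ y≤ (*-monoʳ-≤ (2 * q) (n≤1+n k)))) le)

  -- A later move takes its 2 q vertices from the reserve 2 q (k + 1) already counted; the first one
  -- opens this reserve, and `allowed` bounds it.
  controlled-grow : ∀ q k {x y} → Controlled q (suc k) x → y ≤ x + (q + q) →
    suc k * (q * (Q * 2 ^ q)) ≤ 4 * n → Controlled q k y
  controlled-grow q k {x} {y} (inj₁ refl) y≤ allowed = inj₂ (begin
    (y + 2 * q * k) * (Q * 2 ^ q)           ≤⟨ *-monoˡ-≤ (Q * 2 ^ q) (+-monoˡ-≤ (2 * q * k) y≤) ⟩
    (q + q + 2 * q * k) * (Q * 2 ^ q)       ≡⟨ regroup q k (Q * 2 ^ q) ⟩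
    2 * (suc k * (q * (Q * 2 ^ q)))         ≤⟨ *-monoʳ-≤ 2 allowed ⟩
    2 * (4 * n)                             ≡⟨ *-assoc 2 4 n ⟨
    8 * n                                   ∎)
    where
    open ≤-Reasoning
    regroup : ∀ q k w → (q + q + 2 * q * k) * w ≡ 2 * (suc k * (q * w))
    regroup = solve-∀
  controlled-grow q k {x} {y} (inj₂ le) y≤ _ = inj₂ (begin
    (y + 2 * q * k) * (Q * 2 ^ q)           ≤⟨ *-monoˡ-≤ (Q * 2 ^ q) (+-monoˡ-≤ (2 * q * k) y≤) ⟩
    (x + (q + q) + 2 * q * k) * (Q * 2 ^ q) ≡⟨ cong (_* (Q * 2 ^ q)) (regroup x q k) ⟩
    (x + 2 * q * suc k) * (Q * 2 ^ q)       ≤⟨ le ⟩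
    8 * n                                   ∎)
    where
    open ≤-Reasoning
    regroup : ∀ x q k → x + (q + q) + 2 * q * k ≡ x + 2 * q * suc k
    regroup = solve-∀

  controlled-few : ∀ q k {x} → Controlled q k x → x * (Q * 2 ^ q) ≤ 8 * n
  controlled-few q k (inj₁ refl) = z≤n
  controlled-few q k {x} (inj₂ le) = ≤-trans (*-monoˡ-≤ (Q * 2 ^ q) (m≤m+n x (2 * q * k))) le

  top-forbidden : ∀ k → 3 ≤ Q → n ≤ 2 ^ Q → 4 * n < suc k * (Q * (Q * 2 ^ Q))
  top-forbidden k 3≤Q n≤ = begin-strict
    4 * n                         ≤⟨ *-monoʳ-≤ 4 n≤ ⟩
    4 * 2 ^ Q                     <⟨ *-monoˡ-< (2 ^ Q) {{m^n≢0 2 Q}} (m≤m+n 5 4) ⟩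
    9 * 2 ^ Q                     ≤⟨ *-monoˡ-≤ (2 ^ Q) (*-mono-≤ 3≤Q 3≤Q) ⟩
    Q * Q * 2 ^ Q                 ≡⟨ *-assoc Q Q (2 ^ Q) ⟩
    Q * (Q * 2 ^ Q)               ≤⟨ m≤n*m (Q * (Q * 2 ^ Q)) (suc k) ⟩
    suc k * (Q * (Q * 2 ^ Q))     ∎
    where open ≤-Reasoning

  -- At level `Q` the reserve for a single round already exceeds 8 n, because Q^2 ≥ 9 and 2^Q ≥ n;
  -- so no class has reached size `Q`.
  controlled-top : ∀ k {x} → 3 ≤ Q → n ≤ 2 ^ Q → Controlled Q (suc k) x → x ≡ 0
  controlled-top k 3≤Q n≤ (inj₁ x≡0) = x≡0
  controlled-top k {x} 3≤Q n≤ (inj₂ le) = contradiction (begin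
    2 * (suc k * (Q * (Q * 2 ^ Q)))         ≡⟨ regroup k Q (2 ^ Q) ⟩
    2 * Q * suc k * (Q * 2 ^ Q)             ≤⟨ *-monoˡ-≤ (Q * 2 ^ Q) (m≤n+m (2 * Q * suc k) x) ⟩
    (x + 2 * Q * suc k) * (Q * 2 ^ Q)       ≤⟨ le ⟩
    8 * n                                   ≡⟨ *-assoc 2 4 n ⟩
    2 * (4 * n)                             ∎) (<⇒≱ (*-monoʳ-< 2 (top-forbidden k 3≤Q n≤)))
    where
    open ≤-Reasoning
    regroup : ∀ k Q w → 2 * (suc k * (Q * (Q * w))) ≡ 2 * Q * suc k * (Q * w)
    regroup = solve-∀

  -- Picks a `q` where the weight crosses 4 n: sizes up to `q` may be created, while the excess at
  -- `suc q` is what `enough-room` needs to supply an edge of size sum at most `q`. The search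
  -- starts at 2, where the weight 8 (k + 1) Q is below 30 t Q.
  level : ∀ k t → 3 ≤ Q → n ≤ 2 ^ Q → suc k ≤ t → 30 * (t * Q) ≤ n →
    ∃ λ q → 2 ≤ q × suc q ≤ Q × 4 * n < suc k * (suc q * (Q * 2 ^ suc q)) ×
      (∀ i → i ≤ q → suc k * (i * (Q * 2 ^ i)) ≤ 4 * n)
  level k t 3≤Q n≤ k<t few =
    let i , ¬Pi , Psi = switch-point {P = λ m → 4 * n < weight (2 + m)} (λ m → 4 * n <? weight (2 + m))
          (≤⇒≯ bottom) (Q ∸ 2)
          (subst (λ m → 4 * n < weight m) (sym (m+[n∸m]≡n (≤-trans (n≤1+n 2) 3≤Q))) (top-forbidden k 3≤Q n≤))
    in 2 + i , m≤m+n 2 i , ≰⇒> (λ Q≤ → <⇒≱ (top-forbidden k 3≤Q n≤) (allowed i ¬Pi Q Q≤)) , Psi , allowed i ¬Pi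
    where
    open ≤-Reasoning
    weight : ℕ → ℕ
    weight m = suc k * (m * (Q * 2 ^ m))
    bottom : weight 2 ≤ 4 * n
    bottom = begin
      suc k * (2 * (Q * 4))   ≡⟨ regroup (suc k) Q ⟩
      8 * (suc k * Q)         ≤⟨ *-mono-≤ (m≤m+n 8 22) (*-monoˡ-≤ Q k<t) ⟩
      30 * (t * Q)            ≤⟨ few ⟩
      n                       ≤⟨ m≤n*m n 4 ⟩
      4 * n                   ∎
      where
      regroup : ∀ k Q → k * (2 * (Q * 4)) ≡ 8 * (k * Q)
      regroup = solve-∀
    allowed : ∀ i → ¬ (4 * n < weight (2 + i)) → ∀ m → m ≤ 2 + i → weight m ≤ 4 * n
    allowed i ¬Pi m m≤ = ≤-trans (*-monoʳ-≤ (suc k) (*-mono-≤ m≤ (*-monoʳ-≤ Q (^-monoʳ-≤ 2 m≤)))) (≮⇒≥ ¬Pi)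

-- The game

min-≤ : ∀ {a c} → a ≤ c → min a c ≡ a
min-≤ z≤n       = refl
min-≤ (s≤s a≤c) = cong suc (min-≤ a≤c)

min-≥ : ∀ {a c} → c ≤ a → min a c ≡ c
min-≥ {zero}  z≤n       = refl
min-≥ {suc a} z≤n       = refl
min-≥ {suc a} (s≤s c≤a) = cong suc (min-≥ c≤a)

Unique-resp-↭ : {A : Set} {xs ys : List A} → xs ↭ ys → Unique xs → Unique ys
Unique-resp-↭ {A} p = PermutationSetoid.Unique-resp-↭ (setoid A) (↭⇒↭ₛ p)

Unique-++⁻ʳ : {A : Set} (xs : List A) {ys : List A} → Unique (xs ++ ys) → Unique ys
Unique-++⁻ʳ []       ys!       = ys!
Unique-++⁻ʳ (x ∷ xs) (_ ∷ rest!) = Unique-++⁻ʳ xs rest!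

∈⇒↭ : {A : Set} {x : A} {xs : List A} → x ∈ xs → ∃ λ ys → xs ↭ x ∷ ys
∈⇒↭ {x = x} x∈ with ∈-∃++ x∈
... | as , bs , refl = as ++ bs , shift x as bs

length≡0⇒[] : {A : Set} {xs : List A} → length xs ≡ 0 → xs ≡ []
length≡0⇒[] {xs = []} _ = refl

module _ {n b t r Q : ℕ} (1≤n : 1 ≤ n) (r≤n : r ≤ n) (30nQ≤b : 30 * (n * Q) ≤ b)
  (30tQ≤n : 30 * (t * Q) ≤ n) (n≤2^Q : n ≤ 2 ^ Q) (3≤Q : 3 ≤ Q) where

  private
    1≤Q : 1 ≤ Q
    1≤Q = ≤-trans (s≤s z≤n) 3≤Q

    r≤b : r ≤ b
    r≤b = ≤-trans r≤n (≤-trans (m≤m*n n Q {{>-nonZero 1≤Q}}) (≤-trans (m≤n*m (n * Q) 30) 30nQ≤b))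

  -- The invariant before Avoider's move with `k` rounds left. All rounds but the last are full, so
  -- the same `r` persists in `edges-left`.
  record Position (k : ℕ) (A U : List (Edge n)) : Set where
    field
      label      : Fin n → Fin n
      forest     : Forest A
      respects   : Respects label A
      unique     : Unique U
      edges-left : length U + r ≡ k * suc b
      controlled : ∀ q → 2 ≤ q → q ≤ Q → Controlled n Q q k (length (large label q))

  GoodMove : ℕ → List (Edge n) → List (Edge n) → Set
  GoodMove k A U = ∃ λ u → ∃ λ v → (u , v) ∈ U ×
    ∃ λ c → Forest ((u , v) ∷ A) × Respects c ((u , v) ∷ A) ×
      (∀ q → 2 ≤ q → q ≤ Q → Controlled n Q q k (length (large c q)))

  good-move : ∀ {k A U} → suc k ≤ t → Position (suc k) A U → GoodMove k A U
  good-move {k} {A} {U} k<t pos =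
    let q , 2≤q , q<Q , forbidden , allowed = level n Q k t 3≤Q n≤2^Q k<t 30tQ≤n
        X , blocked≤ , X≤ = blocked-few label Q sizes<Q few q 2≤q (<⇒≤ q<Q)
        room = enough-room n Q (suc q) b r (suc k) (length U) X 1≤n (s≤s z≤n) 1≤Q q<Q r≤n 30nQ≤b
                 edges-left X≤ forbidden
    in join q allowed (free-edge label q unique (≤-<-trans blocked≤ room))
    where
    open Position pos
    sizes<Q : ∀ x → size label x < Q
    sizes<Q = large-empty label Q
      (controlled-top n Q k 3≤Q n≤2^Q (controlled Q (≤-trans (n≤1+n 2) 3≤Q) ≤-refl))
    few : ∀ i → 2 ≤ i → i ≤ Q → length (large label i) * (Q * 2 ^ i) ≤ 8 * n
    few i 2≤i i≤Q = controlled-few n Q i (suc k) (controlled i 2≤i i≤Q)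
    join : ∀ q → (∀ i → i ≤ q → suc k * (i * (Q * 2 ^ i)) ≤ 4 * n) →
      (∃ λ e → e ∈ U × Free label (suc q) e) → GoodMove k A U
    join q allowed ((u , v) , uv∈U , cu≢cv , sum<q) =
      u , v , uv∈U , merge label u v , Forest-∷ label respects u v cu≢cv forest , respects′ , controlled′
      where
      respects′ : Respects (merge label u v) ((u , v) ∷ A)
      respects′ (here refl)   = trans (relabel-target (label u) (label v)) (sym (relabel-source (label u) (label v)))
      respects′ (there xy∈A)  = cong (relabel (label u) (label v)) (respects xy∈A)
      controlled′ : ∀ i → 2 ≤ i → i ≤ Q → Controlled n Q i k (length (large (merge label u v) i))
      controlled′ i 2≤i i≤Q with i ≤? size label u + size label v
      -- A merge creates members of size class i only for i up to the size sum, which is at most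
      -- `q`, where `level` permits it.
      ... | yes i≤ = controlled-grow n Q i k (controlled i 2≤i i≤Q) (large-merge label u v i)
                       (allowed i (s≤s⁻¹ (≤-<-trans i≤ sum<q)))
      ... | no i≰ = controlled-step n Q i k (controlled i 2≤i i≤Q) (large-merge-bounded label u v i (≰⇒> i≰))

  play : ∀ k {A U} → suc k ≤ t → Position (suc k) A U → AvoiderForest b A U
  play k {A} {U} k<t pos = after (good-move k<t pos)
    where
    after : GoodMove k A U → AvoiderForest b A U
    after (u , v , uv∈U , c , forest′ , respects′ , controlled′) =
      move (u , v) U′ U↭ (λ F R F≡ U′↭ → reply k k<t controlled′ edges-left′ F R F≡ U′↭
        (trans (sym (length-++ F)) (sym (↭-length U′↭))))
      where
      U′ : List (Edge n)
      U′ = proj₁ (∈⇒↭ uv∈U)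
      U↭ : U ↭ (u , v) ∷ U′
      U↭ = proj₂ (∈⇒↭ uv∈U)
      edges-left′ : length U′ + r ≡ b + k * suc b
      edges-left′ = suc-injective (trans (cong (_+ r) (sym (↭-length U↭))) (Position.edges-left pos))
      U′-unique : Unique U′
      U′-unique with Unique-resp-↭ U↭ (Position.unique pos)
      ... | _ ∷ U′! = U′!
      reply : ∀ k → suc k ≤ t → (∀ q → 2 ≤ q → q ≤ Q → Controlled n Q q k (length (large c q))) →
        length U′ + r ≡ b + k * suc b → ∀ F R → length F ≡ min b (length U′) → U′ ↭ F ++ R →
        length F + length R ≡ length U′ → AvoiderForest b ((u , v) ∷ _) R
      -- In the last round at most `b` edges remain, so Enforcer must take them all.
      reply zero _ _ left F R F≡ _ F+R = subst (AvoiderForest b _) (sym (length≡0⇒[] R≡0)) (end forest′)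
        where
        U′≤b : length U′ ≤ b
        U′≤b = ≤-trans (m≤m+n (length U′) r) (≤-reflexive (trans left (+-identityʳ b)))
        R≡0 : length R ≡ 0
        R≡0 = +-cancelˡ-≡ (length F) _ _
          (trans F+R (sym (trans (+-identityʳ (length F)) (trans F≡ (min-≥ U′≤b)))))
      reply (suc k) k<t controlled left F R F≡ U′↭ F+R = play k (<⇒≤ k<t) record
        { label      = c
        ; forest     = forest′
        ; respects   = respects′
        ; unique     = Unique-++⁻ʳ F (Unique-resp-↭ U′↭ U′-unique)
        ; edges-left = +-cancelˡ-≡ b _ _ (trans (sym (+-assoc b (length R) r)) (trans (cong (_+ r) b+R) left))
        ; controlled = controlled
        }
        where
        -- At least one more round of `suc b` edges is due, more than the shortfall r ≤ b; hence
        -- Enforcer takes exactly `b`.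
        b≤U′ : b ≤ length U′
        b≤U′ = +-cancelʳ-≤ r b (length U′) (≤-trans
          (+-monoʳ-≤ b (≤-trans r≤b (≤-trans (n≤1+n b) (m≤m+n (suc b) (k * suc b)))))
          (≤-reflexive (sym left)))
        b+R : b + length R ≡ length U′
        b+R = trans (cong (_+ length R) (sym (trans F≡ (min-≤ b≤U′)))) F+R

theorem1p2 : ∃ λ (n₀ : ℕ) → ∀ (n : ℕ) → n₀ ≤ n →
    ∃ λ (b : ℕ) → LowerNLogN 200 n b × UpperNLogN 201 n b × AvoiderCanKeepForest n b
theorem1p2 = 2 ^ 60 , λ n n₀≤n →
  let bias = choose-bias n (length (allEdges n)) n₀≤n (length-allEdges-lower n) (length-allEdges-upper n)
  in Bias.b bias , Bias.lower bias , Bias.upper bias , strategy n (≤-trans (m^n>0 2 60) n₀≤n) bias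
  where
  strategy : ∀ n → 1 ≤ n → (bias : Bias n (length (allEdges n))) → AvoiderCanKeepForest n (Bias.b bias)
  strategy n 1≤n record { t = zero ; N+r≡ = N+r≡0 } =
    subst (AvoiderForest _ []) (sym (length≡0⇒[] (m+n≡0⇒m≡0 _ N+r≡0))) (end Forest-[])
  strategy n 1≤n record { t = suc k ; N+r≡ = N+r≡ ; r≤n = r≤n ; 30nQ≤b = 30nQ≤b ; 30tQ≤n = 30tQ≤n ; n≤2^Q = n≤2^Q ; 3≤Q = 3≤Q } =
    play 1≤n r≤n 30nQ≤b 30tQ≤n n≤2^Q 3≤Q k ≤-refl record
      { label      = id
      ; forest     = Forest-[]
      ; respects   = λ ()
      ; unique     = allEdges-unique n
      ; edges-left = N+r≡
      -- All classes are singletons at the start, so no vertex is large for q ≥ 2.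
      ; controlled = λ q 2≤q _ → inj₁ (large-id n q 2≤q)
      }
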